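{- Let $\lambda$ be a partition and $p$ a positive integer. For every integer $r\ge 0$, \[\sum_{k=1}^{l(\lambda)} d_\lambda(k,p)\,(\lambda_k-k)^r=(-1)^r\sum_{i,j\ge 0}(-1)^j\binom{r}{j}\,s(p+1,i-j)\,c^\lambda_i(p).\]
   Context: For $1\le k\le l(\lambda)$, \[d_\lambda(k,p)=(\lambda_k+l(\lambda)-k)_p\prod_{i=1,\,i\neq k}^{l(\lambda)}\frac{\lambda_k-\lambda_i+i-k-p}{\lambda_k-\lambda_i+i-k},\] where $(z)_p=z(z-1)\cdots(z-p+1)$ is the lowering factorial. The Stirling numbers of the first kind are defined by $(z)_m=\sum_t s(m,t)z^t$, with $s(m,t)=0$ unless $1\le t\le m$ (in particular $s(m,t)=0$ for $t\le 0$). For a finite integer sequence $\lambda=(\lambda_1,\ldots,\lambda_l)$ (for a partition, $l=l(\lambda)$) and an indeterminate $x$, the quantities $c^\lambda_r(x)$, $r\ge0$, are defined by the expansion in descending powers of $y$ \[\prod_{i=1}^{l}\frac{(x-y+1+\lambda_i-i)(-y+1-i)}{(x-y+1-i)(-y+1+\lambda_i-i)}=-x\sum_{r\ge 0}c^\lambda_r(x)\,y^{ -r};\] for a partition the left side equals $\frac{C_\lambda(x-y+1)}{C_\lambda(x-y)}\frac{C_\lambda(-y)}{C_\lambda(-y+1)}$ with $C_\lambda(z)=\prod_{(i,j)\in\lambda}(z+j-i)$ the content polynomial. -}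

module Defs where

open import Data.Nat as ℕ using (ℕ; zero; suc)
open import Data.Nat.Combinatorics using (_C_)
open import Data.Integer as ℤ using (ℤ; +_; -[1+_])
open import Data.Rational as ℚ using (ℚ; 0ℚ; 1ℚ; _+_; _*_; _-_; -_; _÷_; _≟_)
open import Data.Fin as Fin using (Fin; toℕ)
open import Relation.Nullary using (yes; no)
open import Relation.Nullary.Decidable using (does)
open import Data.Bool using (if_then_else_)

ℤtoℚ : ℤ → ℚ
ℤtoℚ z = z ℚ./ 1

ℕtoℚ : ℕ → ℚ
ℕtoℚ n = ℤtoℚ (+ n)

-- total division on ℚ: q ÷' 0 = 0 (only ever used with nonzero denominators)
_÷'_ : ℚ → ℚ → ℚ
p ÷' q with q ≟ 0ℚ
... | yes _ = 0ℚ
... | no q≢0 = _÷_ p q {{ℚ.≢-nonZero q≢0}}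

_^'_ : ℚ → ℕ → ℚ
q ^' zero = 1ℚ
q ^' suc n = q * (q ^' n)

sumℕ : ℕ → (ℕ → ℚ) → ℚ
sumℕ zero f = 0ℚ
sumℕ (suc n) f = sumℕ n f + f n

sumFin : (n : ℕ) → (Fin n → ℚ) → ℚ
sumFin zero f = 0ℚ
sumFin (suc n) f = f Fin.zero + sumFin n (λ i → f (Fin.suc i))

prodFin : (n : ℕ) → (Fin n → ℚ) → ℚ
prodFin zero f = 1ℚ
prodFin (suc n) f = f Fin.zero * prodFin n (λ i → f (Fin.suc i))

-- partitions: λ = (λ_1 ≥ ... ≥ λ_l > 0), stored as λ : Fin l → ℕ, index k ↦ λ_{k+1}
record IsPartition (l : ℕ) (lam : Fin l → ℕ) : Set where
  field
    positive : ∀ i → 1 ℕ.≤ lam i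
    decreasing : ∀ i j → toℕ i ℕ.≤ toℕ j → lam j ℕ.≤ lam i

idx : {l : ℕ} → Fin l → ℤ
idx k = + suc (toℕ k)

fall : ℚ → ℕ → ℚ
fall z zero = 1ℚ
fall z (suc p) = fall z p * (z - ℕtoℚ p)

d : (l : ℕ) → (Fin l → ℕ) → Fin l → ℕ → ℚ
d l lam k p =
  fall (ℤtoℚ (+ lam k ℤ.+ + l ℤ.- idx k)) p *
  prodFin l (λ i → if does (i Fin.≟ k) then 1ℚ else
     (ℤtoℚ (+ lam k ℤ.- + lam i ℤ.+ idx i ℤ.- idx k ℤ.- + p)
       ÷' ℤtoℚ (+ lam k ℤ.- + lam i ℤ.+ idx i ℤ.- idx k)))

-- Signed Stirling numbers of the first kind: (z)_m = Σ_t s(m,t) z^t,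
-- via s(0,0)=1, s(0,t+1)=0, s(m+1,0)=0, s(m+1,t+1)=s(m,t) - m s(m,t+1).
stirlingℕ : ℕ → ℕ → ℤ
stirlingℕ zero zero = + 1
stirlingℕ zero (suc t) = + 0
stirlingℕ (suc m) zero = + 0
stirlingℕ (suc m) (suc t) = stirlingℕ m t ℤ.- (+ m ℤ.* stirlingℕ m (suc t))

stirling : ℕ → ℤ → ℤ
stirling m (+ t) = stirlingℕ m t
stirling m -[1+ _ ] = + 0

-- Formal power series in u = 1/y, as coefficient functions
Series : Set
Series = ℕ → ℚ

_⊛_ : Series → Series → Series
(f ⊛ g) n = sumℕ (suc n) (λ m → f m * g (n ℕ.∸ m))

one : Series
one zero = 1ℚ
one (suc n) = 0ℚ

-- expansion of (a - y)/(b - y) = (1 - a u)/(1 - b u) in powers of u = 1/y: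
-- coefficient of u^0 is 1, of u^(n+1) is b^(n+1) - a b^n
ratio : ℚ → ℚ → Series
ratio a b zero = 1ℚ
ratio a b (suc n) = (b ^' suc n) - a * (b ^' n)

prodSeries : (l : ℕ) → (Fin l → Series) → Series
prodSeries zero f = one
prodSeries (suc l) f = f Fin.zero ⊛ prodSeries l (λ i → f (Fin.suc i))

-- expansion in powers of y^{-1} of
--   Π_i (x-y+1+λ_i-i)(-y+1-i) / ((x-y+1-i)(-y+1+λ_i-i))
lhsSeries : (l : ℕ) → (Fin l → ℕ) → ℚ → Series
lhsSeries l lam x = prodSeries l (λ i →
  ratio (x + ℤtoℚ (+ 1 ℤ.+ + lam i ℤ.- idx i)) (x + ℤtoℚ (+ 1 ℤ.- idx i))
  ⊛ ratio (ℤtoℚ (+ 1 ℤ.- idx i)) (ℤtoℚ (+ 1 ℤ.+ + lam i ℤ.- idx i)))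

-- c^λ_r(x), defined by  LHS = -x Σ_r c_r(x) y^{-r}  (x ≠ 0)
c : (l : ℕ) → (Fin l → ℕ) → ℕ → ℚ → ℚ
c l lam r x = (- lhsSeries l lam x r) ÷' x

{-# OPTIONS --safe #-}

-- Put x = p, aₖ = λₖ - k + 1, and let G(y) be the product defining the c_r. Multiplied by
-- (y)_{p+1} it telescopes to y (y+l-1)_p Πᵢ (y-p-aᵢ)/(y-aᵢ); the simple poles aₖ of
-- (y+l-1)_p Πᵢ (y-p-aᵢ)/(y-aᵢ) have residues -p d(k,p). Hence
-- Σₖ d(k,p) aₖⁿ = Σₜ s(p+1,t) c_{n+t}, and the binomial theorem for (aₖ - 1)^r finishes
-- the proof. A series in u = 1/y is treated as its coefficient sequence, on which y acts
-- as the shift E: multiplication by (y)_{p+1} is then the operator E (E-1) ⋯ (E-p).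

module Submission where

open import Defs
open import Data.Bool using (if_then_else_)
open import Data.Empty using (⊥-elim)
open import Data.Fin as Fin using (Fin; toℕ)
import Data.Fin.Properties as Fin
open import Data.Integer as ℤ using (+_)
import Data.Integer.Properties as ℤ
open import Data.Nat as ℕ using (ℕ; zero; suc; s≤s; z≤n)
import Data.Nat.Properties as ℕ
open import Data.Nat.Combinatorics using (_C_; nCk+nC[k+1]≡[n+1]C[k+1]; k>n⇒nCk≡0)
open import Data.Rational as ℚ using (ℚ; 0ℚ; 1ℚ; _*_; -_)
import Data.Rational.Properties as ℚ
import Data.Rational.Unnormalised as ℚᵘ
import Data.Rational.Unnormalised.Properties as ℚᵘ
open import Data.Sum using (inj₁; inj₂)
open import Function using (_∘_)
open import Level using (0ℓ)
open import Relation.Binary.PropositionalEquality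
open import Relation.Nullary using (yes; no)
open import Relation.Nullary.Decidable using (does; dec⇒maybe)
open import Tactic.RingSolver using (solve-∀)
open import Tactic.RingSolver.Core.AlmostCommutativeRing using (AlmostCommutativeRing; fromCommutativeRing)

-- Sequences are indexed from 0, so E drops the coefficient at index 0. The operators therefore
-- compute modulo polynomials in y, and no polynomial part is ever written down. After the factor y
-- has been split off from (y)_{p+1}, only coefficients of positive index remain, and these are
-- exactly the sums of geometric sequences that a partial fraction decomposition produces. E acts on
-- the sequence a^n as the scalar a, so applying (y+l-1)_p amounts to evaluating it at each pole.
-- The argument y+l-1 arises row by row: starting from (y-1)_p, the pair 1-i, p+1-i of row i trades
-- the lowest factor of the falling factorial for a new highest one and so raises its argument by 1.
-- Two points shape the formalisation. Operators act from the outside, so the telescoping ratios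
-- have to be brought outermost, although the definition of the c_r pairs the numerators
-- differently. Formal series cannot be evaluated at a pole, so the residues are obtained by
-- induction on the number of factors, with an identity between rational numbers supplying the value
-- at the new pole.

module _ where
  open import Data.Rational using (_+_; _-_)
  open ≡-Reasoning

  ℚ-ring : AlmostCommutativeRing 0ℓ 0ℓ
  ℚ-ring = fromCommutativeRing ℚ.+-*-commutativeRing λ x → dec⇒maybe (0ℚ ℚ.≟ x)

  -- The embedding of ℤ into ℚ

  private
    toℚᵘ-ℤtoℚ : ∀ i → ℚ.toℚᵘ (ℤtoℚ i) ℚᵘ.≃ ℚᵘ.mkℚᵘ i 0
    toℚᵘ-ℤtoℚ i = ℚ.toℚᵘ-fromℚᵘ (ℚᵘ.mkℚᵘ i 0)

  ℤtoℚ-+ : ∀ i j → ℤtoℚ (i ℤ.+ j) ≡ ℤtoℚ i + ℤtoℚ j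
  ℤtoℚ-+ i j = ℚ.toℚᵘ-injective (ℚᵘ.≃-trans (toℚᵘ-ℤtoℚ (i ℤ.+ j)) (ℚᵘ.≃-trans
    (ℚᵘ.*≡* (cong (ℤ._* + 1) (sym (cong₂ ℤ._+_ (ℤ.*-identityʳ i) (ℤ.*-identityʳ j)))))
    (ℚᵘ.≃-sym (ℚᵘ.≃-trans (ℚ.toℚᵘ-homo-+ (ℤtoℚ i) (ℤtoℚ j))
      (ℚᵘ.+-cong (toℚᵘ-ℤtoℚ i) (toℚᵘ-ℤtoℚ j))))))

  ℤtoℚ-* : ∀ i j → ℤtoℚ (i ℤ.* j) ≡ ℤtoℚ i * ℤtoℚ j
  ℤtoℚ-* i j = ℚ.toℚᵘ-injective (ℚᵘ.≃-trans (toℚᵘ-ℤtoℚ (i ℤ.* j))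
    (ℚᵘ.≃-sym (ℚᵘ.≃-trans (ℚ.toℚᵘ-homo-* (ℤtoℚ i) (ℤtoℚ j))
      (ℚᵘ.*-cong (toℚᵘ-ℤtoℚ i) (toℚᵘ-ℤtoℚ j)))))

  ℤtoℚ-neg : ∀ i → ℤtoℚ (ℤ.- i) ≡ - ℤtoℚ i
  ℤtoℚ-neg i = ℚ.toℚᵘ-injective (ℚᵘ.≃-trans (toℚᵘ-ℤtoℚ (ℤ.- i))
    (ℚᵘ.≃-sym (ℚᵘ.≃-trans (ℚ.toℚᵘ-homo‿- (ℤtoℚ i)) (ℚᵘ.-‿cong (toℚᵘ-ℤtoℚ i)))))

  ℤtoℚ-minus : ∀ i j → ℤtoℚ (i ℤ.- j) ≡ ℤtoℚ i - ℤtoℚ j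
  ℤtoℚ-minus i j = trans (ℤtoℚ-+ i (ℤ.- j)) (cong (λ s → ℤtoℚ i + s) (ℤtoℚ-neg j))

  ℤtoℚ-injective : ∀ {i j} → ℤtoℚ i ≡ ℤtoℚ j → i ≡ j
  ℤtoℚ-injective {i} {j} eq = trans (sym (ℤ.*-identityʳ i)) (trans
    (ℚᵘ.drop-*≡* (ℚ.fromℚᵘ-injective {ℚᵘ.mkℚᵘ i 0} {ℚᵘ.mkℚᵘ j 0} eq)) (ℤ.*-identityʳ j))

  ℕtoℚ-suc : ∀ n → ℕtoℚ (suc n) ≡ 1ℚ + ℕtoℚ n
  ℕtoℚ-suc n = ℤtoℚ-+ (+ 1) (+ n)

  -- Division

  ÷'-cancel : ∀ x {y} → y ≢ 0ℚ → y * (x ÷' y) ≡ x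
  ÷'-cancel x {y} y≢0 with y ℚ.≟ 0ℚ
  ... | yes y≡0 = ⊥-elim (y≢0 y≡0)
  ... | no y≢0' = begin
    y * (x * y⁻¹)  ≡⟨ rearrange y x y⁻¹ ⟩
    x * (y * y⁻¹)  ≡⟨ cong (x *_) (ℚ.*-inverseʳ y {{ℚ.≢-nonZero y≢0'}}) ⟩
    x * 1ℚ         ≡⟨ ℚ.*-identityʳ x ⟩
    x              ∎
    where
    y⁻¹ = (ℚ.1/ y) {{ℚ.≢-nonZero y≢0'}}
    rearrange : ∀ y x z → y * (x * z) ≡ x * (y * z)
    rearrange = solve-∀ ℚ-ring

  ÷'-*ˡ : ∀ u x y → (u * x) ÷' y ≡ u * (x ÷' y)
  ÷'-*ˡ u x y with y ℚ.≟ 0ℚ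
  ... | yes _ = sym (ℚ.*-zeroʳ u)
  ... | no _ = ℚ.*-assoc u x _

  -- By the default value it also holds at `y = 0`. The reciprocal then becomes an indeterminate for
  -- the ring solver, and `÷'-cancel` supplies its defining relation.
  ÷'-inverse : ∀ x y → x ÷' y ≡ x * (1ℚ ÷' y)
  ÷'-inverse x y = trans (cong (_÷' y) (sym (ℚ.*-identityʳ x))) (÷'-*ˡ x 1ℚ y)

  minus≢0 : ∀ {x y} → x ≢ y → x - y ≢ 0ℚ
  minus≢0 {x} {y} x≢y eq = x≢y (trans (rearrange x y) (trans (cong (_+ y) eq) (ℚ.+-identityˡ y)))
    where
    rearrange : ∀ x y → x ≡ (x - y) + y
    rearrange = solve-∀ ℚ-ring

  -- Finite sums

  sumℕ-cong< : ∀ n {f g : ℕ → ℚ} → (∀ i → i ℕ.< n → f i ≡ g i) → sumℕ n f ≡ sumℕ n g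
  sumℕ-cong< zero eq = refl
  sumℕ-cong< (suc n) eq =
    cong₂ _+_ (sumℕ-cong< n λ i i<n → eq i (ℕ.m<n⇒m<1+n i<n)) (eq n ℕ.≤-refl)

  sumℕ-cong : ∀ n {f g : ℕ → ℚ} → (∀ i → f i ≡ g i) → sumℕ n f ≡ sumℕ n g
  sumℕ-cong n eq = sumℕ-cong< n λ i _ → eq i

  -- The termwise identity is a hypothesis, so a linear recurrence between sums reduces to a ring
  -- identity between their terms.
  sumℕ-linear : ∀ n u v {f g h : ℕ → ℚ} → (∀ i → f i ≡ u * g i + v * h i) →
                sumℕ n f ≡ u * sumℕ n g + v * sumℕ n h
  sumℕ-linear zero u v eq = rearrange u v
    where
    rearrange : ∀ u v → 0ℚ ≡ u * 0ℚ + v * 0ℚ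
    rearrange = solve-∀ ℚ-ring
  sumℕ-linear (suc n) u v {f} {g} {h} eq =
    trans (cong₂ _+_ (sumℕ-linear n u v eq) (eq n)) (rearrange u v (sumℕ n g) (sumℕ n h) (g n) (h n))
    where
    rearrange : ∀ u v G H x y → u * G + v * H + (u * x + v * y) ≡ u * (G + x) + v * (H + y)
    rearrange = solve-∀ ℚ-ring

  sumℕ-+ : ∀ n (f g : ℕ → ℚ) → sumℕ n (λ i → f i + g i) ≡ sumℕ n f + sumℕ n g
  sumℕ-+ n f g = trans
    (sumℕ-linear n 1ℚ 1ℚ λ i → cong₂ _+_ (sym (ℚ.*-identityˡ (f i))) (sym (ℚ.*-identityˡ (g i))))
    (cong₂ _+_ (ℚ.*-identityˡ (sumℕ n f)) (ℚ.*-identityˡ (sumℕ n g)))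

  sumℕ-*ˡ : ∀ n u (f : ℕ → ℚ) → sumℕ n (λ i → u * f i) ≡ u * sumℕ n f
  sumℕ-*ˡ zero u f = sym (ℚ.*-zeroʳ u)
  sumℕ-*ˡ (suc n) u f =
    trans (cong (_+ u * f n) (sumℕ-*ˡ n u f)) (sym (ℚ.*-distribˡ-+ u (sumℕ n f) (f n)))

  sumℕ-zero : ∀ n {f : ℕ → ℚ} → (∀ i → i ℕ.< n → f i ≡ 0ℚ) → sumℕ n f ≡ 0ℚ
  sumℕ-zero zero eq = refl
  sumℕ-zero (suc n) eq =
    cong₂ _+_ (sumℕ-zero n λ i i<n → eq i (ℕ.m<n⇒m<1+n i<n)) (eq n ℕ.≤-refl)

  sumℕ-split : ∀ m n (f : ℕ → ℚ) → sumℕ (m ℕ.+ n) f ≡ sumℕ m f + sumℕ n (λ i → f (m ℕ.+ i))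
  sumℕ-split m zero f = trans (cong (λ k → sumℕ k f) (ℕ.+-identityʳ m)) (sym (ℚ.+-identityʳ _))
  sumℕ-split m (suc n) f = begin
    sumℕ (m ℕ.+ suc n) f                                      ≡⟨ cong (λ k → sumℕ k f) (ℕ.+-suc m n) ⟩
    sumℕ (m ℕ.+ n) f + f (m ℕ.+ n)                            ≡⟨ cong (_+ f (m ℕ.+ n)) (sumℕ-split m n f) ⟩
    sumℕ m f + sumℕ n (λ i → f (m ℕ.+ i)) + f (m ℕ.+ n)       ≡⟨ ℚ.+-assoc (sumℕ m f) _ _ ⟩
    sumℕ m f + (sumℕ n (λ i → f (m ℕ.+ i)) + f (m ℕ.+ n))     ∎

  sumℕ-head : ∀ n (f : ℕ → ℚ) → sumℕ (suc n) f ≡ f 0 + sumℕ n (f ∘ suc)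
  sumℕ-head n f = trans (sumℕ-split 1 n f) (cong (_+ sumℕ n (f ∘ suc)) (ℚ.+-identityˡ (f 0)))

  sumℕ-swap : ∀ m n (f : ℕ → ℕ → ℚ) →
              sumℕ m (λ i → sumℕ n (f i)) ≡ sumℕ n (λ j → sumℕ m (λ i → f i j))
  sumℕ-swap zero n f = sym (sumℕ-zero n λ _ _ → refl)
  sumℕ-swap (suc m) n f = trans (cong (_+ sumℕ n (f m)) (sumℕ-swap m n f))
    (sym (sumℕ-+ n (λ j → sumℕ m (λ i → f i j)) (f m)))

  sumFin-cong : ∀ l {f g : Fin l → ℚ} → (∀ k → f k ≡ g k) → sumFin l f ≡ sumFin l g
  sumFin-cong zero eq = refl
  sumFin-cong (suc l) eq = cong₂ _+_ (eq Fin.zero) (sumFin-cong l (eq ∘ Fin.suc))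

  prodFin-cong : ∀ l {f g : Fin l → ℚ} → (∀ k → f k ≡ g k) → prodFin l f ≡ prodFin l g
  prodFin-cong zero eq = refl
  prodFin-cong (suc l) eq = cong₂ _*_ (eq Fin.zero) (prodFin-cong l (eq ∘ Fin.suc))

  sumFin-linear : ∀ l u v {f g h : Fin l → ℚ} → (∀ k → f k ≡ u * g k + v * h k) →
                  sumFin l f ≡ u * sumFin l g + v * sumFin l h
  sumFin-linear zero u v eq = rearrange u v
    where
    rearrange : ∀ u v → 0ℚ ≡ u * 0ℚ + v * 0ℚ
    rearrange = solve-∀ ℚ-ring
  sumFin-linear (suc l) u v {f} {g} {h} eq =
    trans (cong₂ _+_ (eq Fin.zero) (sumFin-linear l u v (eq ∘ Fin.suc)))
      (rearrange u v (g Fin.zero) (h Fin.zero) (sumFin l (g ∘ Fin.suc)) (sumFin l (h ∘ Fin.suc)))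
    where
    rearrange : ∀ u v x y G H → u * x + v * y + (u * G + v * H) ≡ u * (x + G) + v * (y + H)
    rearrange = solve-∀ ℚ-ring

  sumFin-*ˡ : ∀ l u (f : Fin l → ℚ) → sumFin l (λ k → u * f k) ≡ u * sumFin l f
  sumFin-*ˡ zero u f = sym (ℚ.*-zeroʳ u)
  sumFin-*ˡ (suc l) u f = trans (cong (λ s → u * f Fin.zero + s) (sumFin-*ˡ l u (f ∘ Fin.suc)))
    (sym (ℚ.*-distribˡ-+ u (f Fin.zero) (sumFin l (f ∘ Fin.suc))))

  sumFin-sumℕ-swap : ∀ l n (f : Fin l → ℕ → ℚ) →
                     sumFin l (λ k → sumℕ n (f k)) ≡ sumℕ n (λ j → sumFin l (λ k → f k j))
  sumFin-sumℕ-swap zero n f = sym (sumℕ-zero n λ _ _ → refl)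
  sumFin-sumℕ-swap (suc l) n f = trans (cong (λ s → sumℕ n (f Fin.zero) + s) (sumFin-sumℕ-swap l n (f ∘ Fin.suc)))
    (sym (sumℕ-+ n (f Fin.zero) λ j → sumFin l (λ k → f (Fin.suc k) j)))

  -- The binomial theorem

  -- This is (-1)^r times the expansion of (1 - x)^r, which produces the sign (-1)^r of the theorem.
  -- The induction uses x - 1 = -(1 - x) and Pascal's rule.
  alternating-binomial : ∀ x r →
    (x - 1ℚ) ^' r ≡ ((- 1ℚ) ^' r) * sumℕ (suc r) (λ j → ((- 1ℚ) ^' j) * ℕtoℚ (r C j) * (x ^' j))
  alternating-binomial x zero = refl
  alternating-binomial x (suc r) = begin
    (x - 1ℚ) * ((x - 1ℚ) ^' r)                      ≡⟨ cong ((x - 1ℚ) *_) (alternating-binomial x r) ⟩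
    (x - 1ℚ) * (((- 1ℚ) ^' r) * sumℕ (suc r) (term r)) ≡⟨ rearrange₁ x ((- 1ℚ) ^' r) (sumℕ (suc r) (term r)) ⟩
    - 1ℚ * ((- 1ℚ) ^' r) * (sumℕ (suc r) (term r) + (- x) * sumℕ (suc r) (term r))
      ≡⟨ cong (λ s → ((- 1ℚ) ^' suc r) * s) (sym recurrence) ⟩
    ((- 1ℚ) ^' suc r) * sumℕ (suc (suc r)) (term (suc r)) ∎
    where
    term : ℕ → ℕ → ℚ
    term r j = ((- 1ℚ) ^' j) * ℕtoℚ (r C j) * (x ^' j)
    rearrange₁ : ∀ x e s → (x - 1ℚ) * (e * s) ≡ - 1ℚ * e * (s + (- x) * s)
    rearrange₁ = solve-∀ ℚ-ring
    rearrange₂ : ∀ x e b b' y → - 1ℚ * e * (b + b') * (x * y) ≡ 1ℚ * (- 1ℚ * e * b' * (x * y)) + (- x) * (e * b * y)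
    rearrange₂ = solve-∀ ℚ-ring
    pascal : ∀ j → term (suc r) (suc j) ≡ 1ℚ * term r (suc j) + (- x) * term r j
    pascal j = trans
      (cong (λ b → ((- 1ℚ) ^' suc j) * b * (x ^' suc j)) (trans
        (cong ℕtoℚ (sym (nCk+nC[k+1]≡[n+1]C[k+1] r j))) (ℤtoℚ-+ (+ (r C j)) (+ (r C suc j)))))
      (rearrange₂ x ((- 1ℚ) ^' j) (ℕtoℚ (r C j)) (ℕtoℚ (r C suc j)) (x ^' j))
    -- Reindexing by Pascal's rule reaches one index past `r`; the binomial coefficient vanishes
    -- there.
    last-term : term r (suc r) ≡ 0ℚ
    last-term = begin
      ((- 1ℚ) ^' suc r) * ℕtoℚ (r C suc r) * (x ^' suc r)
        ≡⟨ cong (λ b → ((- 1ℚ) ^' suc r) * ℕtoℚ b * (x ^' suc r)) (k>n⇒nCk≡0 (ℕ.n<1+n r)) ⟩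
      ((- 1ℚ) ^' suc r) * 0ℚ * (x ^' suc r)  ≡⟨ cong (_* (x ^' suc r)) (ℚ.*-zeroʳ ((- 1ℚ) ^' suc r)) ⟩
      0ℚ * (x ^' suc r)                      ≡⟨ ℚ.*-zeroˡ (x ^' suc r) ⟩
      0ℚ                                     ∎
    recurrence : sumℕ (suc (suc r)) (term (suc r)) ≡ sumℕ (suc r) (term r) + (- x) * sumℕ (suc r) (term r)
    recurrence = begin
      sumℕ (suc (suc r)) (term (suc r))
        ≡⟨ sumℕ-head (suc r) (term (suc r)) ⟩
      term r 0 + sumℕ (suc r) (term (suc r) ∘ suc)
        ≡⟨ cong (λ s → term r 0 + s) (sumℕ-linear (suc r) 1ℚ (- x) pascal) ⟩
      term r 0 + (1ℚ * sumℕ (suc r) (term r ∘ suc) + (- x) * sumℕ (suc r) (term r))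
        ≡⟨ rearrange₃ (term r 0) (sumℕ (suc r) (term r ∘ suc)) _ ⟩
      (term r 0 + sumℕ (suc r) (term r ∘ suc)) + (- x) * sumℕ (suc r) (term r)
        ≡⟨ cong (_+ (- x) * sumℕ (suc r) (term r)) (sym (sumℕ-head (suc r) (term r))) ⟩
      (sumℕ (suc r) (term r) + term r (suc r)) + (- x) * sumℕ (suc r) (term r)
        ≡⟨ cong (_+ (- x) * sumℕ (suc r) (term r)) (trans (cong (λ s → sumℕ (suc r) (term r) + s) last-term) (ℚ.+-identityʳ (sumℕ (suc r) (term r)))) ⟩
      sumℕ (suc r) (term r) + (- x) * sumℕ (suc r) (term r) ∎
      where
      rearrange₃ : ∀ t s y → t + (1ℚ * s + y) ≡ (t + s) + y
      rearrange₃ = solve-∀ ℚ-ring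

  -- Multiplication of series by (1 - a u)/(1 - b u)

  infix 4 _≈_
  _≈_ : Series → Series → Set
  f ≈ g = ∀ n → f n ≡ g n

  -- The result g is determined by (1 - b u) g = (1 - a u) f, read coefficient by coefficient. As a
  -- recursion it avoids convolutions and meets the shift operators directly.
  mulRatio : ℚ → ℚ → Series → Series
  mulRatio a b f zero = f 0
  mulRatio a b f (suc n) = b * mulRatio a b f n + (f (suc n) - a * f n)

  mulRatio-cong : ∀ a b {f g} → f ≈ g → mulRatio a b f ≈ mulRatio a b g
  mulRatio-cong a b eq zero = eq 0
  mulRatio-cong a b eq (suc n) =
    cong₂ (λ s t → b * s + t) (mulRatio-cong a b eq n) (cong₂ (λ s t → s - a * t) (eq (suc n)) (eq n))

  ratio≈mulRatio : ∀ a b → ratio a b ≈ mulRatio a b one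
  ratio≈mulRatio a b zero = refl
  ratio≈mulRatio a b (suc zero) = rearrange a b
    where
    rearrange : ∀ a b → b * 1ℚ - a * 1ℚ ≡ b * 1ℚ + (0ℚ - a * 1ℚ)
    rearrange = solve-∀ ℚ-ring
  ratio≈mulRatio a b (suc (suc n)) =
    trans (rearrange a b (b ^' n)) (cong (λ s → b * s + (0ℚ - a * 0ℚ)) (ratio≈mulRatio a b (suc n)))
    where
    rearrange : ∀ a b y → b * (b * y) - a * (b * y) ≡ b * (b * y - a * y) + (0ℚ - a * 0ℚ)
    rearrange = solve-∀ ℚ-ring

  ⊛-congʳ : ∀ {f f'} g → f ≈ f' → f ⊛ g ≈ f' ⊛ g
  ⊛-congʳ g eq n = sumℕ-cong (suc n) λ m → cong (_* g (n ℕ.∸ m)) (eq m)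

  one-⊛ : ∀ f → one ⊛ f ≈ f
  one-⊛ f n = begin
    sumℕ (suc n) (λ m → one m * f (n ℕ.∸ m))
      ≡⟨ sumℕ-head n _ ⟩
    1ℚ * f n + sumℕ n (λ m → 0ℚ * f (n ℕ.∸ suc m))
      ≡⟨ cong₂ _+_ (ℚ.*-identityˡ (f n)) (sumℕ-zero n λ m _ → ℚ.*-zeroˡ (f (n ℕ.∸ suc m))) ⟩
    f n + 0ℚ
      ≡⟨ ℚ.+-identityʳ (f n) ⟩
    f n ∎

  -- The left side satisfies the recursion that defines the right side. This is the instance of
  -- associativity of `⊛` that turns products of ratios into composed operators.
  mulRatio-⊛ : ∀ a b f g → mulRatio a b f ⊛ g ≈ mulRatio a b (f ⊛ g)
  mulRatio-⊛ a b f g zero = refl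
  mulRatio-⊛ a b f g (suc n) = begin
    (mulRatio a b f ⊛ g) (suc n)
      ≡⟨ sumℕ-head (suc n) _ ⟩
    f 0 * g (suc n) + sumℕ (suc n) (λ m → mulRatio a b f (suc m) * g (n ℕ.∸ m))
      ≡⟨ cong (λ s → f 0 * g (suc n) + s) (sumℕ-linear (suc n) 1ℚ 1ℚ
           λ m → rearrange₁ a b (mulRatio a b f m) (f (suc m)) (f m) (g (n ℕ.∸ m))) ⟩
    f 0 * g (suc n) +
      (1ℚ * sumℕ (suc n) (λ m → f (suc m) * g (n ℕ.∸ m)) +
       1ℚ * sumℕ (suc n) (λ m → b * (mulRatio a b f m * g (n ℕ.∸ m)) + (- a) * (f m * g (n ℕ.∸ m))))
      ≡⟨ cong (λ s → f 0 * g (suc n) + (1ℚ * sumℕ (suc n) (λ m → f (suc m) * g (n ℕ.∸ m)) + 1ℚ * s))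
           (sumℕ-linear (suc n) b (- a) λ _ → refl) ⟩
    f 0 * g (suc n) +
      (1ℚ * sumℕ (suc n) (λ m → f (suc m) * g (n ℕ.∸ m)) +
       1ℚ * (b * (mulRatio a b f ⊛ g) n + (- a) * (f ⊛ g) n))
      ≡⟨ rearrange₂ a b (f 0 * g (suc n)) _ ((mulRatio a b f ⊛ g) n) ((f ⊛ g) n) ⟩
    b * (mulRatio a b f ⊛ g) n +
      ((f 0 * g (suc n) + sumℕ (suc n) (λ m → f (suc m) * g (n ℕ.∸ m))) - a * (f ⊛ g) n)
      ≡⟨ cong₂ (λ s t → b * s + (t - a * (f ⊛ g) n)) (mulRatio-⊛ a b f g n) (sym (sumℕ-head (suc n) _)) ⟩
    b * mulRatio a b (f ⊛ g) n + ((f ⊛ g) (suc n) - a * (f ⊛ g) n) ∎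
    where
    rearrange₁ : ∀ a b s x y z →
      (b * s + (x - a * y)) * z ≡ 1ℚ * (x * z) + 1ℚ * (b * (s * z) + (- a) * (y * z))
    rearrange₁ = solve-∀ ℚ-ring
    rearrange₂ : ∀ a b x s y z → x + (1ℚ * s + 1ℚ * (b * y + (- a) * z)) ≡ b * y + ((x + s) - a * z)
    rearrange₂ = solve-∀ ℚ-ring

  ratio-⊛ : ∀ a b f → ratio a b ⊛ f ≈ mulRatio a b f
  ratio-⊛ a b f n = begin
    (ratio a b ⊛ f) n         ≡⟨ ⊛-congʳ f (ratio≈mulRatio a b) n ⟩
    (mulRatio a b one ⊛ f) n  ≡⟨ mulRatio-⊛ a b one f n ⟩
    mulRatio a b (one ⊛ f) n  ≡⟨ mulRatio-cong a b (one-⊛ f) n ⟩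
    mulRatio a b f n          ∎

  ratio-ratio-⊛ : ∀ a b a' b' f → (ratio a b ⊛ ratio a' b') ⊛ f ≈ mulRatio a b (mulRatio a' b' f)
  ratio-ratio-⊛ a b a' b' f n = begin
    ((ratio a b ⊛ ratio a' b') ⊛ f) n     ≡⟨ ⊛-congʳ f (ratio-⊛ a b (ratio a' b')) n ⟩
    (mulRatio a b (ratio a' b') ⊛ f) n    ≡⟨ mulRatio-⊛ a b (ratio a' b') f n ⟩
    mulRatio a b (ratio a' b' ⊛ f) n      ≡⟨ mulRatio-cong a b (ratio-⊛ a' b' f) n ⟩
    mulRatio a b (mulRatio a' b' f) n     ∎

  -- mulRatio a b ∘ mulRatio a' b' depends on a, a' and b, b' only through their
  -- elementary symmetric functions.
  mulRatio² : ∀ a b a' b' f n → mulRatio a b (mulRatio a' b' f) (suc (suc n)) ≡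
    (b + b') * mulRatio a b (mulRatio a' b' f) (suc n) - b * b' * mulRatio a b (mulRatio a' b' f) n
      + (f (suc (suc n)) - (a + a') * f (suc n) + a * a' * f n)
  mulRatio² a b a' b' f n =
    rearrange a b a' b' (mulRatio a b (mulRatio a' b' f) n) (mulRatio a' b' f n) (f n) (f (suc n)) (f (suc (suc n)))
    where
    rearrange : ∀ a b a' b' L X x x₁ x₂ →
      b * (b * L + ((b' * X + (x₁ - a' * x)) - a * X)) +
        ((b' * (b' * X + (x₁ - a' * x)) + (x₂ - a' * x₁)) - a * (b' * X + (x₁ - a' * x))) ≡
      (b + b') * (b * L + ((b' * X + (x₁ - a' * x)) - a * X)) - b * b' * L + (x₂ - (a + a') * x₁ + a * a' * x)
    rearrange = solve-∀ ℚ-ring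

  -- Both composites obey the same second-order recurrence and agree at indices 0 and 1.
  mulRatio-symmetric : ∀ a b a' b' α β α' β' f →
    a + a' ≡ α + α' → a * a' ≡ α * α' → b + b' ≡ β + β' → b * b' ≡ β * β' →
    mulRatio a b (mulRatio a' b' f) ≈ mulRatio α β (mulRatio α' β' f)
  mulRatio-symmetric a b a' b' α β α' β' f e₁ e₂ e₃ e₄ zero = refl
  mulRatio-symmetric a b a' b' α β α' β' f e₁ e₂ e₃ e₄ (suc zero) = begin
    b * f 0 + ((b' * f 0 + (f 1 - a' * f 0)) - a * f 0)  ≡⟨ collect a b a' b' (f 0) (f 1) ⟩
    (b + b') * f 0 + f 1 - (a + a') * f 0                ≡⟨ cong₂ (λ s t → s * f 0 + f 1 - t * f 0) e₃ e₁ ⟩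
    (β + β') * f 0 + f 1 - (α + α') * f 0                ≡⟨ collect α β α' β' (f 0) (f 1) ⟨
    β * f 0 + ((β' * f 0 + (f 1 - α' * f 0)) - α * f 0)  ∎
    where
    collect : ∀ a b a' b' x x₁ →
      b * x + ((b' * x + (x₁ - a' * x)) - a * x) ≡ (b + b') * x + x₁ - (a + a') * x
    collect = solve-∀ ℚ-ring
  mulRatio-symmetric a b a' b' α β α' β' f e₁ e₂ e₃ e₄ (suc (suc n)) = begin
    L (suc (suc n))
      ≡⟨ mulRatio² a b a' b' f n ⟩
    (b + b') * L (suc n) - b * b' * L n + (f (suc (suc n)) - (a + a') * f (suc n) + a * a' * f n)
      ≡⟨ cong₂ _+_
           (cong₂ _-_ (cong₂ _*_ e₃ (mulRatio-symmetric a b a' b' α β α' β' f e₁ e₂ e₃ e₄ (suc n)))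
                      (cong₂ _*_ e₄ (mulRatio-symmetric a b a' b' α β α' β' f e₁ e₂ e₃ e₄ n)))
           (cong₂ (λ s t → f (suc (suc n)) - s * f (suc n) + t * f n) e₁ e₂) ⟩
    (β + β') * R (suc n) - β * β' * R n + (f (suc (suc n)) - (α + α') * f (suc n) + α * α' * f n)
      ≡⟨ mulRatio² α β α' β' f n ⟨
    R (suc (suc n)) ∎
    where
    L = mulRatio a b (mulRatio a' b' f)
    R = mulRatio α β (mulRatio α' β' f)

  mulRatio-comm : ∀ a b a' b' f → mulRatio a b (mulRatio a' b' f) ≈ mulRatio a' b' (mulRatio a b f)
  mulRatio-comm a b a' b' f = mulRatio-symmetric a b a' b' a' b' a b f
    (ℚ.+-comm a a') (ℚ.*-comm a a') (ℚ.+-comm b b') (ℚ.*-comm b b')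

  -- Only the numerators trade places; this re-pairs the four linear factors of one row.
  mulRatio-exchange : ∀ a b a' b' f → mulRatio a b (mulRatio a' b' f) ≈ mulRatio a' b (mulRatio a b' f)
  mulRatio-exchange a b a' b' f = mulRatio-symmetric a b a' b' a' b a b' f (ℚ.+-comm a a') (ℚ.*-comm a a') refl refl

  -- Products of several ratios

  mulRatios : ∀ l → (Fin l → ℚ) → (Fin l → ℚ) → Series → Series
  mulRatios zero a b f = f
  mulRatios (suc l) a b f = mulRatio (a Fin.zero) (b Fin.zero) (mulRatios l (a ∘ Fin.suc) (b ∘ Fin.suc) f)

  mulRatio-mulRatios : ∀ l α β a b f → mulRatio α β (mulRatios l a b f) ≈ mulRatios l a b (mulRatio α β f)
  mulRatio-mulRatios zero α β a b f n = refl
  mulRatio-mulRatios (suc l) α β a b f n = trans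
    (mulRatio-comm α β (a Fin.zero) (b Fin.zero) _ n)
    (mulRatio-cong (a Fin.zero) (b Fin.zero) (mulRatio-mulRatios l α β (a ∘ Fin.suc) (b ∘ Fin.suc) f) n)

  mulRatios-zero : ∀ l a b f → mulRatios l a b f 0 ≡ f 0
  mulRatios-zero zero a b f = refl
  mulRatios-zero (suc l) a b f = mulRatios-zero l (a ∘ Fin.suc) (b ∘ Fin.suc) f

  -- In the application `a'` over `b` is the pair 1-i, p+1-i, which telescopes and must stand
  -- outermost to meet the falling factorial. The inner product then has the numerators p + aᵢ and
  -- the poles aᵢ.
  prodSeries-ratios : ∀ l (a b a' b' : Fin l → ℚ) →
    prodSeries l (λ i → ratio (a i) (b i) ⊛ ratio (a' i) (b' i)) ≈ mulRatios l a' b (mulRatios l a b' one)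
  prodSeries-ratios zero a b a' b' n = refl
  prodSeries-ratios (suc l) a b a' b' n = begin
    ((ratio a₀ b₀ ⊛ ratio a₀' b₀') ⊛ rest) n
      ≡⟨ ratio-ratio-⊛ a₀ b₀ a₀' b₀' rest n ⟩
    mulRatio a₀ b₀ (mulRatio a₀' b₀' rest) n
      ≡⟨ mulRatio-exchange a₀ b₀ a₀' b₀' rest n ⟩
    mulRatio a₀' b₀ (mulRatio a₀ b₀' rest) n
      ≡⟨ mulRatio-cong a₀' b₀ (λ m → trans
           (mulRatio-cong a₀ b₀' (prodSeries-ratios l _ _ _ _) m)
           (mulRatio-mulRatios l a₀ b₀' _ _ _ m)) n ⟩
    mulRatio a₀' b₀ (mulRatios l (a' ∘ Fin.suc) (b ∘ Fin.suc)
      (mulRatio a₀ b₀' (mulRatios l (a ∘ Fin.suc) (b' ∘ Fin.suc) one))) n ∎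
    where
    a₀ = a Fin.zero
    b₀ = b Fin.zero
    a₀' = a' Fin.zero
    b₀' = b' Fin.zero
    rest = prodSeries l (λ i → ratio (a (Fin.suc i)) (b (Fin.suc i)) ⊛ ratio (a' (Fin.suc i)) (b' (Fin.suc i)))

  -- Falling factorials of shift operators

  -- (c + E)_m, where E is the shift (E f) n = f (n + 1).
  fallShift : ℚ → ℕ → Series → Series
  fallShift c zero f = f
  fallShift c (suc m) f n = fallShift c m f (suc n) + (c - ℕtoℚ m) * fallShift c m f n

  fallShift-cong : ∀ c m {f g} → f ≈ g → fallShift c m f ≈ fallShift c m g
  fallShift-cong c zero eq = eq
  fallShift-cong c (suc m) eq n =
    cong₂ (λ s t → s + (c - ℕtoℚ m) * t) (fallShift-cong c m eq (suc n)) (fallShift-cong c m eq n)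

  fallShift-shift : ∀ c m f → fallShift c m (f ∘ suc) ≈ fallShift c m f ∘ suc
  fallShift-shift c zero f n = refl
  fallShift-shift c (suc m) f n =
    cong₂ (λ s t → s + (c - ℕtoℚ m) * t) (fallShift-shift c m f (suc n)) (fallShift-shift c m f n)

  fallShift-comm : ∀ c m e f n →
    fallShift c m (λ k → f (suc k) + e * f k) n ≡ fallShift c m f (suc n) + e * fallShift c m f n
  fallShift-comm c zero e f n = refl
  fallShift-comm c (suc m) e f n = trans
    (cong₂ (λ s t → s + (c - ℕtoℚ m) * t) (fallShift-comm c m e f (suc n)) (fallShift-comm c m e f n))
    (rearrange e (c - ℕtoℚ m) (fallShift c m f n) (fallShift c m f (suc n)) (fallShift c m f (suc (suc n))))
    where
    rearrange : ∀ e c x x₁ x₂ → (x₂ + e * x₁) + c * (x₁ + e * x) ≡ (x₂ + c * x₁) + e * (x₁ + c * x)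
    rearrange = solve-∀ ℚ-ring

  -- The definition of `fallShift` splits off the lowest factor of the falling factorial; this
  -- splits off the highest and lets it act first.
  fallShift-top : ∀ c m f n →
    fallShift (1ℚ + c) (suc m) f n ≡ fallShift c m (λ k → f (suc k) + (1ℚ + c) * f k) n
  fallShift-top c zero f n = cong (λ s → f (suc n) + s * f n) (ℚ.+-identityʳ (1ℚ + c))
  fallShift-top c (suc m) f n = begin
    fallShift (1ℚ + c) (suc m) f (suc n) + (1ℚ + c - ℕtoℚ (suc m)) * fallShift (1ℚ + c) (suc m) f n
      ≡⟨ cong (λ s → fallShift (1ℚ + c) (suc m) f (suc n) + s * fallShift (1ℚ + c) (suc m) f n)
           (trans (cong (λ s → 1ℚ + c - s) (ℕtoℚ-suc m)) (rearrange c (ℕtoℚ m))) ⟩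
    fallShift (1ℚ + c) (suc m) f (suc n) + (c - ℕtoℚ m) * fallShift (1ℚ + c) (suc m) f n
      ≡⟨ cong₂ (λ s t → s + (c - ℕtoℚ m) * t) (fallShift-top c m f (suc n)) (fallShift-top c m f n) ⟩
    fallShift c (suc m) (λ k → f (suc k) + (1ℚ + c) * f k) n ∎
    where
    rearrange : ∀ c m → 1ℚ + c - (1ℚ + m) ≡ c - m
    rearrange = solve-∀ ℚ-ring

  -- With p = `suc m`, the lowest factor y - p - β of (y-1-β)_p is the denominator of the ratio.
  -- Cancelling it and adding the numerator y - β on top leaves (y-β)_p.
  fallShift-mulRatio : ∀ m β f n →
    fallShift (- 1ℚ - β) (suc m) (mulRatio β (ℕtoℚ (suc m) + β) f) n ≡ fallShift (- β) (suc m) f n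
  fallShift-mulRatio m β f n = begin
    fallShift γ (suc m) h n
      -- The lowest factor is moved inside to act on `h` itself, where the recursion of `mulRatio`
      -- cancels it.
      ≡⟨ fallShift-comm γ m (γ - ℕtoℚ m) h n ⟨
    fallShift γ m (λ k → h (suc k) + (γ - ℕtoℚ m) * h k) n
      ≡⟨ fallShift-cong γ m (λ k → trans
           (cong (λ s → (s + β) * h k + (f (suc k) - β * f k) + (γ - ℕtoℚ m) * h k) (ℕtoℚ-suc m))
           (rearrange₁ β (ℕtoℚ m) (h k) (f k) (f (suc k)))) n ⟩
    fallShift γ m (λ k → f (suc k) + (1ℚ + γ) * f k) n
      ≡⟨ fallShift-top γ m f n ⟨
    fallShift (1ℚ + γ) (suc m) f n
      ≡⟨ cong (λ s → fallShift s (suc m) f n) (rearrange₂ β) ⟩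
    fallShift (- β) (suc m) f n ∎
    where
    γ = - 1ℚ - β
    h = mulRatio β (ℕtoℚ (suc m) + β) f
    rearrange₁ : ∀ β m y x x₁ → (1ℚ + m + β) * y + (x₁ - β * x) + (- 1ℚ - β - m) * y ≡ x₁ + (1ℚ + (- 1ℚ - β)) * x
    rearrange₁ = solve-∀ ℚ-ring
    rearrange₂ : ∀ β → 1ℚ + (- 1ℚ - β) ≡ - β
    rearrange₂ = solve-∀ ℚ-ring

  -- The product of (y - βᵢ)/(y - p - βᵢ) over consecutive βᵢ telescopes.
  fallShift-mulRatios : ∀ m l β₀ (β : Fin l → ℚ) → (∀ i → β i ≡ β₀ - ℕtoℚ (toℕ i)) → ∀ f n →
    fallShift (- 1ℚ - β₀) (suc m) (mulRatios l β (λ i → ℕtoℚ (suc m) + β i) f) n ≡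
    fallShift (- 1ℚ - β₀ + ℕtoℚ l) (suc m) f n
  fallShift-mulRatios m zero β₀ β eq f n = cong (λ s → fallShift s (suc m) f n) (sym (ℚ.+-identityʳ _))
  fallShift-mulRatios m (suc l) β₀ β eq f n = begin
    fallShift (- 1ℚ - β₀) (suc m) (mulRatio (β Fin.zero) (ℕtoℚ (suc m) + β Fin.zero) rest) n
      ≡⟨ cong (λ s → fallShift (- 1ℚ - s) (suc m) (mulRatio (β Fin.zero) (ℕtoℚ (suc m) + β Fin.zero) rest) n)
           (trans (sym (ℚ.+-identityʳ β₀)) (sym (eq Fin.zero))) ⟩
    fallShift (- 1ℚ - β Fin.zero) (suc m) (mulRatio (β Fin.zero) (ℕtoℚ (suc m) + β Fin.zero) rest) n
      ≡⟨ fallShift-mulRatio m (β Fin.zero) rest n ⟩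
    fallShift (- β Fin.zero) (suc m) rest n
      ≡⟨ cong (λ s → fallShift s (suc m) rest n) (trans (cong -_ (eq Fin.zero)) (rearrange₁ β₀)) ⟩
    fallShift (- 1ℚ - (β₀ - 1ℚ)) (suc m) rest n
      ≡⟨ fallShift-mulRatios m l (β₀ - 1ℚ) (β ∘ Fin.suc) (λ i → trans (eq (Fin.suc i))
           (trans (cong (λ s → β₀ - s) (ℕtoℚ-suc (toℕ i))) (rearrange₂ β₀ (ℕtoℚ (toℕ i))))) f n ⟩
    fallShift (- 1ℚ - (β₀ - 1ℚ) + ℕtoℚ l) (suc m) f n
      ≡⟨ cong (λ s → fallShift s (suc m) f n)
           (trans (rearrange₃ β₀ (ℕtoℚ l)) (cong (λ s → - 1ℚ - β₀ + s) (sym (ℕtoℚ-suc l)))) ⟩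
    fallShift (- 1ℚ - β₀ + ℕtoℚ (suc l)) (suc m) f n ∎
    where
    rest = mulRatios l (β ∘ Fin.suc) (λ i → ℕtoℚ (suc m) + β (Fin.suc i)) f
    rearrange₁ : ∀ β → - (β - 0ℚ) ≡ - 1ℚ - (β - 1ℚ)
    rearrange₁ = solve-∀ ℚ-ring
    rearrange₂ : ∀ β i → β - (1ℚ + i) ≡ β - 1ℚ - i
    rearrange₂ = solve-∀ ℚ-ring
    rearrange₃ : ∀ β l → - 1ℚ - (β - 1ℚ) + l ≡ - 1ℚ - β + (1ℚ + l)
    rearrange₃ = solve-∀ ℚ-ring

  -- A geometric sequence with ratio `a i` is an eigenvector of E with eigenvalue `a i`, so a
  -- polynomial in E acts on it by its value there.
  fallShift-geometric : ∀ c m l (ρ a : Fin l → ℚ) n →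
    fallShift c m (λ k → sumFin l (λ i → ρ i * (a i ^' k))) n ≡
    sumFin l (λ i → ρ i * fall (a i + c) m * (a i ^' n))
  fallShift-geometric c zero l ρ a n =
    sumFin-cong l λ i → cong (_* (a i ^' n)) (sym (ℚ.*-identityʳ (ρ i)))
  fallShift-geometric c (suc m) l ρ a n = begin
    fallShift c m F (suc n) + (c - ℕtoℚ m) * fallShift c m F n
      ≡⟨ cong₂ (λ s t → s + (c - ℕtoℚ m) * t) (fallShift-geometric c m l ρ a (suc n)) (fallShift-geometric c m l ρ a n) ⟩
    S (suc n) + (c - ℕtoℚ m) * S n
      ≡⟨ cong (_+ (c - ℕtoℚ m) * S n) (sym (ℚ.*-identityˡ (S (suc n)))) ⟩
    1ℚ * S (suc n) + (c - ℕtoℚ m) * S n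
      ≡⟨ sumFin-linear l 1ℚ (c - ℕtoℚ m) (λ i → rearrange (ρ i) (fall (a i + c) m) (a i) c (ℕtoℚ m) (a i ^' n)) ⟨
    sumFin l (λ i → ρ i * fall (a i + c) (suc m) * (a i ^' n)) ∎
    where
    F : Series
    F k = sumFin l (λ i → ρ i * (a i ^' k))
    S : Series
    S k = sumFin l (λ i → ρ i * fall (a i + c) m * (a i ^' k))
    rearrange : ∀ ρ φ a c m y →
      ρ * (φ * (a + c - m)) * y ≡ 1ℚ * (ρ * φ * (a * y)) + (c - m) * (ρ * φ * y)
    rearrange = solve-∀ ℚ-ring

  -- Stirling numbers as coefficients of falling factorials

  stirlingℕ-zero : ∀ m t → m ℕ.< t → stirlingℕ m t ≡ + 0
  stirlingℕ-zero zero (suc t) _ = refl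
  stirlingℕ-zero (suc m) (suc t) (s≤s m<t) =
    trans (cong₂ (λ x y → x ℤ.- + m ℤ.* y) (stirlingℕ-zero m t m<t) (stirlingℕ-zero m (suc t) (ℕ.m<n⇒m<1+n m<t)))
      (cong (λ y → + 0 ℤ.- y) (ℤ.*-zeroʳ (+ m)))

  -- This is (z)_m = Σₜ s(m,t) zᵗ with z replaced by E, whose power Eᵗ sends f n to f (n + t).
  fallShift-stirling : ∀ m f n → fallShift 0ℚ m f n ≡ sumℕ (suc m) (λ t → ℤtoℚ (stirlingℕ m t) * f (n ℕ.+ t))
  fallShift-stirling zero f n = begin
    f n                              ≡⟨ cong f (sym (ℕ.+-identityʳ n)) ⟩
    f (n ℕ.+ 0)                      ≡⟨ rearrange (f (n ℕ.+ 0)) ⟩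
    0ℚ + 1ℚ * f (n ℕ.+ 0)            ∎
    where
    rearrange : ∀ x → x ≡ 0ℚ + 1ℚ * x
    rearrange = solve-∀ ℚ-ring
  fallShift-stirling (suc m) f n = begin
    fallShift 0ℚ m f (suc n) + (0ℚ - ℕtoℚ m) * fallShift 0ℚ m f n
      ≡⟨ cong₂ (λ s t → s + (0ℚ - ℕtoℚ m) * t) (fallShift-stirling m f (suc n)) (fallShift-stirling m f n) ⟩
    sumℕ (suc m) (λ t → s t * f (suc n ℕ.+ t)) + (0ℚ - ℕtoℚ m) * sumℕ (suc m) (λ t → s t * f (n ℕ.+ t))
      ≡⟨ cong (λ y → sumℕ (suc m) (λ t → s t * f (suc n ℕ.+ t)) + (0ℚ - ℕtoℚ m) * y) extend ⟩
    sumℕ (suc m) (λ t → s t * f (suc n ℕ.+ t)) +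
      (0ℚ - ℕtoℚ m) * (s 0 * f (n ℕ.+ 0) + sumℕ (suc m) (λ t → s (suc t) * f (n ℕ.+ suc t)))
      ≡⟨ rearrange₁ (ℕtoℚ m) (sumℕ (suc m) (λ t → s t * f (suc n ℕ.+ t))) (s 0 * f (n ℕ.+ 0))
           (sumℕ (suc m) (λ t → s (suc t) * f (n ℕ.+ suc t))) ⟩
    - (ℕtoℚ m * (s 0 * f (n ℕ.+ 0))) + (1ℚ * sumℕ (suc m) (λ t → s t * f (suc n ℕ.+ t)) +
      (0ℚ - ℕtoℚ m) * sumℕ (suc m) (λ t → s (suc t) * f (n ℕ.+ suc t)))
      ≡⟨ cong₂ _+_ head (sym (sumℕ-linear (suc m) 1ℚ (0ℚ - ℕtoℚ m) recurrence)) ⟩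
    ℤtoℚ (stirlingℕ (suc m) 0) * f (n ℕ.+ 0) +
      sumℕ (suc m) (λ t → ℤtoℚ (stirlingℕ (suc m) (suc t)) * f (n ℕ.+ suc t))
      ≡⟨ sumℕ-head (suc m) _ ⟨
    sumℕ (suc (suc m)) (λ t → ℤtoℚ (stirlingℕ (suc m) t) * f (n ℕ.+ t)) ∎
    where
    s : ℕ → ℚ
    s t = ℤtoℚ (stirlingℕ m t)
    -- Either m = 0 or s(m,0) = 0. This matches the constant term with s(m+1,0) = 0.
    m*s0 : ∀ m → ℕtoℚ m * ℤtoℚ (stirlingℕ m 0) ≡ 0ℚ
    m*s0 zero = refl
    m*s0 (suc m) = ℚ.*-zeroʳ (ℕtoℚ (suc m))
    head : - (ℕtoℚ m * (s 0 * f (n ℕ.+ 0))) ≡ 0ℚ * f (n ℕ.+ 0)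
    head = begin
      - (ℕtoℚ m * (s 0 * f (n ℕ.+ 0)))  ≡⟨ cong -_ (sym (ℚ.*-assoc (ℕtoℚ m) (s 0) (f (n ℕ.+ 0)))) ⟩
      - (ℕtoℚ m * s 0 * f (n ℕ.+ 0))    ≡⟨ cong (λ y → - (y * f (n ℕ.+ 0))) (m*s0 m) ⟩
      - (0ℚ * f (n ℕ.+ 0))              ≡⟨ rearrange (f (n ℕ.+ 0)) ⟩
      0ℚ * f (n ℕ.+ 0)                  ∎
      where
      rearrange : ∀ x → - (0ℚ * x) ≡ 0ℚ * x
      rearrange = solve-∀ ℚ-ring
    -- Appending the zero term s(m,m+1) gives the tail as many terms as the other sum, so that the
    -- two combine termwise.
    extend : sumℕ (suc m) (λ t → s t * f (n ℕ.+ t)) ≡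
             s 0 * f (n ℕ.+ 0) + sumℕ (suc m) (λ t → s (suc t) * f (n ℕ.+ suc t))
    extend = begin
      sumℕ (suc m) (λ t → s t * f (n ℕ.+ t))
        ≡⟨ ℚ.+-identityʳ _ ⟨
      sumℕ (suc m) (λ t → s t * f (n ℕ.+ t)) + 0ℚ
        ≡⟨ cong (λ y → sumℕ (suc m) (λ t → s t * f (n ℕ.+ t)) + y) (trans
             (cong (λ y → ℤtoℚ y * f (n ℕ.+ suc m)) (stirlingℕ-zero m (suc m) ℕ.≤-refl))
             (ℚ.*-zeroˡ (f (n ℕ.+ suc m)))) ⟨
      sumℕ (suc (suc m)) (λ t → s t * f (n ℕ.+ t))
        ≡⟨ sumℕ-head (suc m) _ ⟩
      s 0 * f (n ℕ.+ 0) + sumℕ (suc m) (λ t → s (suc t) * f (n ℕ.+ suc t)) ∎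
    rearrange₁ : ∀ m x y z → x + (0ℚ - m) * (y + z) ≡ - (m * y) + (1ℚ * x + (0ℚ - m) * z)
    rearrange₁ = solve-∀ ℚ-ring
    rearrange₂ : ∀ m x y z → (x - m * y) * z ≡ 1ℚ * (x * z) + (0ℚ - m) * (y * z)
    rearrange₂ = solve-∀ ℚ-ring
    recurrence : ∀ t → ℤtoℚ (stirlingℕ (suc m) (suc t)) * f (n ℕ.+ suc t) ≡
      1ℚ * (s t * f (suc n ℕ.+ t)) + (0ℚ - ℕtoℚ m) * (s (suc t) * f (n ℕ.+ suc t))
    recurrence t = begin
      ℤtoℚ (stirlingℕ (suc m) (suc t)) * f (n ℕ.+ suc t)
        ≡⟨ cong (_* f (n ℕ.+ suc t)) (trans (ℤtoℚ-minus (stirlingℕ m t) (+ m ℤ.* stirlingℕ m (suc t)))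
             (cong (λ y → s t - y) (ℤtoℚ-* (+ m) (stirlingℕ m (suc t))))) ⟩
      (s t - ℕtoℚ m * s (suc t)) * f (n ℕ.+ suc t)
        ≡⟨ rearrange₂ (ℕtoℚ m) (s t) (s (suc t)) (f (n ℕ.+ suc t)) ⟩
      1ℚ * (s t * f (n ℕ.+ suc t)) + (0ℚ - ℕtoℚ m) * (s (suc t) * f (n ℕ.+ suc t))
        ≡⟨ cong (λ k → 1ℚ * (s t * f k) + (0ℚ - ℕtoℚ m) * (s (suc t) * f (n ℕ.+ suc t))) (ℕ.+-suc n t) ⟩
      1ℚ * (s t * f (suc n ℕ.+ t)) + (0ℚ - ℕtoℚ m) * (s (suc t) * f (n ℕ.+ suc t)) ∎

  private
    stirling-neg : ∀ m k → 0 ℕ.< k → stirling m (ℤ.- (+ k)) ≡ + 0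
    stirling-neg m (suc k) _ = refl

  stirling-< : ∀ m {i j} → i ℕ.< j → stirling m (+ i ℤ.- + j) ≡ + 0
  stirling-< m {i} {j} i<j = trans
    (cong (stirling m) (trans (ℤ.m-n≡m⊖n i j) (ℤ.⊖-< i<j)))
    (stirling-neg m (j ℕ.∸ i) (ℕ.m<n⇒0<n∸m i<j))

  stirling-+ : ∀ m j t → stirling m (+ (j ℕ.+ t) ℤ.- + j) ≡ stirlingℕ m t
  stirling-+ m j t = cong (stirling m) (trans (ℤ.m-n≡m⊖n (j ℕ.+ t) j)
    (trans (ℤ.⊖-≥ (ℕ.m≤m+n j t)) (cong +_ (ℕ.m+n∸m≡n j t))))

  -- Terms with i < j vanish because the second argument of `stirling` is negative, those with i > j
  -- + m because it exceeds m. The slack `e` allows one common summation range for all j.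
  sumℕ-stirling-shift : ∀ m j e (f : ℕ → ℚ) →
    sumℕ (j ℕ.+ (suc m ℕ.+ e)) (λ i → ℤtoℚ (stirling m (+ i ℤ.- + j)) * f i) ≡
    sumℕ (suc m) (λ t → ℤtoℚ (stirlingℕ m t) * f (j ℕ.+ t))
  sumℕ-stirling-shift m j e f = begin
    sumℕ (j ℕ.+ (suc m ℕ.+ e)) F
      ≡⟨ sumℕ-split j (suc m ℕ.+ e) F ⟩
    sumℕ j F + sumℕ (suc m ℕ.+ e) (λ t → F (j ℕ.+ t))
      ≡⟨ cong₂ _+_ (sumℕ-zero j λ i i<j → vanish (stirling-< m i<j) (f i))
           (sumℕ-cong (suc m ℕ.+ e) λ t → cong (λ s → ℤtoℚ s * f (j ℕ.+ t)) (stirling-+ m j t)) ⟩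
    0ℚ + sumℕ (suc m ℕ.+ e) H
      ≡⟨ ℚ.+-identityˡ _ ⟩
    sumℕ (suc m ℕ.+ e) H
      ≡⟨ sumℕ-split (suc m) e H ⟩
    sumℕ (suc m) H + sumℕ e (λ t → H (suc m ℕ.+ t))
      ≡⟨ cong (λ s → sumℕ (suc m) H + s) (sumℕ-zero e λ t _ →
           vanish (stirlingℕ-zero m (suc m ℕ.+ t) (ℕ.m≤m+n (suc m) t)) (f (j ℕ.+ (suc m ℕ.+ t)))) ⟩
    sumℕ (suc m) H + 0ℚ
      ≡⟨ ℚ.+-identityʳ _ ⟩
    sumℕ (suc m) H ∎
    where
    F H : ℕ → ℚ
    F i = ℤtoℚ (stirling m (+ i ℤ.- + j)) * f i
    H t = ℤtoℚ (stirlingℕ m t) * f (j ℕ.+ t)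
    vanish : ∀ {s} → s ≡ + 0 → ∀ x → ℤtoℚ s * x ≡ 0ℚ
    vanish refl x = ℚ.*-zeroˡ x

  -- Partial fractions

  -- The residue of Πᵢ (z - b i)/(z - a i) at the simple pole z = `a k`, with the omitted factor
  -- encoded as in `d` so that the two products can be compared factor by factor.
  residue : ∀ l → (Fin l → ℚ) → (Fin l → ℚ) → Fin l → ℚ
  residue l b a k = (a k - b k) *
    prodFin l (λ i → if does (i Fin.≟ k) then 1ℚ else ((a k - b i) ÷' (a k - a i)))

  residue-suc : ∀ l (b a : Fin (suc l) → ℚ) k → residue (suc l) b a (Fin.suc k) ≡
    (a (Fin.suc k) - b Fin.zero) * (1ℚ ÷' (a (Fin.suc k) - a Fin.zero)) * residue l (b ∘ Fin.suc) (a ∘ Fin.suc) k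
  residue-suc l b a k = trans
    (cong (λ q → x * (q * P)) (÷'-inverse (a (Fin.suc k) - b Fin.zero) (a (Fin.suc k) - a Fin.zero)))
    (swap x ((a (Fin.suc k) - b Fin.zero) * (1ℚ ÷' (a (Fin.suc k) - a Fin.zero))) P)
    where
    x = a (Fin.suc k) - b (Fin.suc k)
    P = prodFin l λ i → if does (i Fin.≟ k) then 1ℚ
      else ((a (Fin.suc k) - b (Fin.suc i)) ÷' (a (Fin.suc k) - a (Fin.suc i)))
    swap : ∀ x q P → x * (q * P) ≡ q * (x * P)
    swap = solve-∀ ℚ-ring

  private
    opposite-inverse : ∀ a k K K' → (k - a) * K ≡ 1ℚ → (a - k) * K' ≡ 1ℚ → - K ≡ K'
    opposite-inverse a k K K' hK hK' = begin
      - K                       ≡⟨ ℚ.*-identityʳ (- K) ⟨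
      - K * 1ℚ                  ≡⟨ cong (- K *_) (sym hK') ⟩
      - K * ((a - k) * K')      ≡⟨ rearrange a k K K' ⟩
      (k - a) * K * K'          ≡⟨ cong (_* K') hK ⟩
      1ℚ * K'                   ≡⟨ ℚ.*-identityˡ K' ⟩
      K'                        ∎
      where
      rearrange : ∀ a k K K' → - K * ((a - k) * K') ≡ (k - a) * K * K'
      rearrange = solve-∀ ℚ-ring

    -- The core is (k-b)(z-a) = (z-b)(k-a) + (a-b)(z-k). The reciprocals enter as variables
    -- constrained by their defining equations, as the ring solver requires.
    split-product : ∀ a b z k ρ A B K K' →
      (z - a) * A ≡ 1ℚ → (z - k) * B ≡ 1ℚ → (k - a) * K ≡ 1ℚ → (a - k) * K' ≡ 1ℚ →
      (k - b) * K * ρ * B ≡ (z - b) * A * (ρ * B) + (- ((a - b) * A)) * (ρ * K')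
    split-product a b z k ρ A B K K' hA hB hK hK' = begin
      (k - b) * K * ρ * B
        ≡⟨ ℚ.*-identityʳ _ ⟨
      (k - b) * K * ρ * B * 1ℚ
        ≡⟨ cong ((k - b) * K * ρ * B *_) (sym hA) ⟩
      (k - b) * K * ρ * B * ((z - a) * A)
        ≡⟨ rearrange a b z k ρ A B K ⟩
      (z - b) * A * (ρ * B) * ((k - a) * K) + (- ((a - b) * A)) * (ρ * (- K)) * ((z - k) * B)
        ≡⟨ cong₂ _+_ (trans (cong ((z - b) * A * (ρ * B) *_) hK) (ℚ.*-identityʳ ((z - b) * A * (ρ * B))))
             (trans (cong ((- ((a - b) * A)) * (ρ * (- K)) *_) hB) (ℚ.*-identityʳ ((- ((a - b) * A)) * (ρ * (- K))))) ⟩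
      (z - b) * A * (ρ * B) + (- ((a - b) * A)) * (ρ * (- K))
        ≡⟨ cong (λ s → (z - b) * A * (ρ * B) + (- ((a - b) * A)) * (ρ * s)) (opposite-inverse a k K K' hK hK') ⟩
      (z - b) * A * (ρ * B) + (- ((a - b) * A)) * (ρ * K') ∎
      where
      rearrange : ∀ a b z k ρ A B K → (k - b) * K * ρ * B * ((z - a) * A) ≡
        (z - b) * A * (ρ * B) * ((k - a) * K) + (- ((a - b) * A)) * (ρ * (- K)) * ((z - k) * B)
      rearrange = solve-∀ ℚ-ring

  -- Induction on the number of factors: multiplying ρₖ/(z - aₖ) by the new factor leaves a
  -- remainder at the new pole a₀. The remainders add up through the induction hypothesis at z = a₀,
  -- which is why z is arbitrary.
  partial-fractions : ∀ l (b a : Fin l → ℚ) → (∀ {i k} → a i ≡ a k → i ≡ k) →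
    ∀ z → (∀ i → z ≢ a i) →
    prodFin l (λ i → (z - b i) ÷' (z - a i)) ≡ 1ℚ + sumFin l (λ k → residue l b a k ÷' (z - a k))
  partial-fractions zero b a a-inj z z∉a = refl
  partial-fractions (suc l) b a a-inj z z∉a = begin
    ((z - b₀) ÷' (z - a₀)) * prodFin l (λ i → (z - b (Fin.suc i)) ÷' (z - a (Fin.suc i)))
      ≡⟨ cong₂ _*_ (÷'-inverse (z - b₀) (z - a₀)) (partial-fractions l _ _ a'-inj z (z∉a ∘ Fin.suc)) ⟩
    (z - b₀) * A * (1ℚ + Σz)
      ≡⟨ rearrange a₀ b₀ z A Σz Σa₀ ⟩
    (z - a₀) * A + ((a₀ - b₀) * (1ℚ * (1ℚ + Σa₀)) * A + ((z - b₀) * A * Σz + (- ((a₀ - b₀) * A)) * Σa₀))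
      ≡⟨ cong₂ _+_ (÷'-cancel 1ℚ (minus≢0 (z∉a Fin.zero))) (cong₂ _+_ head (sym (sumFin-linear l ((z - b₀) * A) (- ((a₀ - b₀) * A)) tail))) ⟩
    1ℚ + (residue (suc l) b a Fin.zero ÷' (z - a₀) +
      sumFin l (λ k → residue (suc l) b a (Fin.suc k) ÷' (z - a (Fin.suc k)))) ∎
    where
    a₀ = a Fin.zero
    b₀ = b Fin.zero
    A = 1ℚ ÷' (z - a₀)
    ρ : Fin l → ℚ
    ρ = residue l (b ∘ Fin.suc) (a ∘ Fin.suc)
    a'-inj : ∀ {i k} → a (Fin.suc i) ≡ a (Fin.suc k) → i ≡ k
    a'-inj eq = Fin.suc-injective (a-inj eq)
    a₀≢ : ∀ i → a₀ ≢ a (Fin.suc i)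
    a₀≢ i eq with a-inj eq
    ... | ()
    Σz = sumFin l (λ k → ρ k ÷' (z - a (Fin.suc k)))
    Σa₀ = sumFin l (λ k → ρ k ÷' (a₀ - a (Fin.suc k)))
    head : (a₀ - b₀) * (1ℚ * (1ℚ + Σa₀)) * A ≡ residue (suc l) b a Fin.zero ÷' (z - a₀)
    head = trans
      (cong (λ s → (a₀ - b₀) * (1ℚ * s) * A) (sym (partial-fractions l _ _ a'-inj a₀ a₀≢)))
      (sym (÷'-inverse (residue (suc l) b a Fin.zero) (z - a₀)))
    tail : ∀ k → residue (suc l) b a (Fin.suc k) ÷' (z - a (Fin.suc k)) ≡
      (z - b₀) * A * (ρ k ÷' (z - a (Fin.suc k))) + (- ((a₀ - b₀) * A)) * (ρ k ÷' (a₀ - a (Fin.suc k)))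
    tail k = begin
      residue (suc l) b a (Fin.suc k) ÷' (z - aₖ)
        ≡⟨ ÷'-inverse (residue (suc l) b a (Fin.suc k)) (z - aₖ) ⟩
      residue (suc l) b a (Fin.suc k) * B
        ≡⟨ cong (_* B) (residue-suc l b a k) ⟩
      (aₖ - b₀) * K * ρ k * B
        ≡⟨ split-product a₀ b₀ z aₖ (ρ k) A B K K'
             (÷'-cancel 1ℚ (minus≢0 (z∉a Fin.zero))) (÷'-cancel 1ℚ (minus≢0 (z∉a (Fin.suc k))))
             (÷'-cancel 1ℚ (minus≢0 (a₀≢ k ∘ sym))) (÷'-cancel 1ℚ (minus≢0 (a₀≢ k))) ⟩
      (z - b₀) * A * (ρ k * B) + (- ((a₀ - b₀) * A)) * (ρ k * K')
        ≡⟨ cong₂ (λ s t → (z - b₀) * A * s + (- ((a₀ - b₀) * A)) * t)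
             (sym (÷'-inverse (ρ k) (z - aₖ))) (sym (÷'-inverse (ρ k) (a₀ - aₖ))) ⟩
      (z - b₀) * A * (ρ k ÷' (z - aₖ)) + (- ((a₀ - b₀) * A)) * (ρ k ÷' (a₀ - aₖ)) ∎
      where
      aₖ = a (Fin.suc k)
      B = 1ℚ ÷' (z - aₖ)
      K = 1ℚ ÷' (aₖ - a₀)
      K' = 1ℚ ÷' (a₀ - aₖ)
    rearrange : ∀ a b z A S T → (z - b) * A * (1ℚ + S) ≡
      (z - a) * A + ((a - b) * (1ℚ * (1ℚ + T)) * A + ((z - b) * A * S + (- ((a - b) * A)) * T))
    rearrange = solve-∀ ℚ-ring

  -- This is the partial fraction decomposition expanded at infinity, where 1/(y - a) = Σₙ aⁿ
  -- u^(n+1); the constant 1 sits at index 0. The induction adds one factor at a time, and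
  -- `partial-fractions` at the single point a₀ identifies the new residue.
  mulRatios-coefficients : ∀ l (b a : Fin l → ℚ) → (∀ {i k} → a i ≡ a k → i ≡ k) → ∀ n →
    mulRatios l b a one (suc n) ≡ sumFin l (λ k → residue l b a k * (a k ^' n))
  mulRatios-coefficients zero b a a-inj n = refl
  mulRatios-coefficients (suc l) b a a-inj = coefficients
    where
    a₀ = a Fin.zero
    b₀ = b Fin.zero
    a' b' ρ : Fin l → ℚ
    a' = a ∘ Fin.suc
    b' = b ∘ Fin.suc
    ρ = residue l b' a'
    a'-inj : ∀ {i k} → a' i ≡ a' k → i ≡ k
    a'-inj eq = Fin.suc-injective (a-inj eq)
    a₀≢ : ∀ i → a₀ ≢ a' i
    a₀≢ i eq with a-inj eq
    ... | ()
    R₀ = residue (suc l) b a Fin.zero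
    R : Fin l → ℚ
    R k = residue (suc l) b a (Fin.suc k)
    h = mulRatios l b' a' one
    H = mulRatios (suc l) b a one
    Σa₀ = sumFin l (λ k → ρ k ÷' (a₀ - a' k))

    -- Each old residue loses a multiple of ρₖ/(a₀ - aₖ). The total loss is what `R₀` contains
    -- beyond a₀ - b₀, so the coefficient of u comes out right.
    initial : ∀ k → R k * 1ℚ ≡ 1ℚ * (ρ k * 1ℚ) + (- (a₀ - b₀)) * (ρ k ÷' (a₀ - a' k))
    initial k = begin
      R k * 1ℚ
        ≡⟨ cong (_* 1ℚ) (residue-suc l b a k) ⟩
      (a' k - b₀) * K * ρ k * 1ℚ
        ≡⟨ rearrange a₀ b₀ (a' k) (ρ k) K ⟩
      ρ k * ((a' k - a₀) * K) + (- (a₀ - b₀)) * (ρ k * (- K))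
        ≡⟨ cong₂ (λ s t → ρ k * s + (- (a₀ - b₀)) * (ρ k * t)) hK (opposite-inverse a₀ (a' k) K K' hK hK') ⟩
      ρ k * 1ℚ + (- (a₀ - b₀)) * (ρ k * K')
        ≡⟨ cong₂ (λ s t → s + (- (a₀ - b₀)) * t)
             (sym (ℚ.*-identityˡ (ρ k * 1ℚ))) (sym (÷'-inverse (ρ k) (a₀ - a' k))) ⟩
      1ℚ * (ρ k * 1ℚ) + (- (a₀ - b₀)) * (ρ k ÷' (a₀ - a' k)) ∎
      where
      K = 1ℚ ÷' (a' k - a₀)
      K' = 1ℚ ÷' (a₀ - a' k)
      hK = ÷'-cancel 1ℚ (minus≢0 (a₀≢ k ∘ sym))
      hK' = ÷'-cancel 1ℚ (minus≢0 (a₀≢ k))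
      rearrange : ∀ a b k ρ K →
        (k - b) * K * ρ * 1ℚ ≡ ρ * ((k - a) * K) + (- (a - b)) * (ρ * (- K))
      rearrange = solve-∀ ℚ-ring

    -- Since (aₖ - a₀) Rₖ = (aₖ - b₀) ρₖ, the sequence Rₖ aₖⁿ solves the recursion with the old
    -- terms as inhomogeneity; R₀ a₀ⁿ solves the homogeneous one.
    step : ∀ n k → R k * (a' k * (a' k ^' n)) ≡
      a₀ * (R k * (a' k ^' n)) + 1ℚ * (1ℚ * (ρ k * (a' k * (a' k ^' n))) + (- b₀) * (ρ k * (a' k ^' n)))
    step n k = begin
      R k * (a' k * y)
        ≡⟨ cong (_* (a' k * y)) (residue-suc l b a k) ⟩
      (a' k - b₀) * K * ρ k * (a' k * y)
        ≡⟨ rearrange₁ a₀ b₀ (a' k) (ρ k) K y ⟩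
      a₀ * ((a' k - b₀) * K * ρ k * y) + (a' k - b₀) * ρ k * y * ((a' k - a₀) * K)
        ≡⟨ cong₂ (λ s t → a₀ * (s * y) + (a' k - b₀) * ρ k * y * t)
             (sym (residue-suc l b a k)) (÷'-cancel 1ℚ (minus≢0 (a₀≢ k ∘ sym))) ⟩
      a₀ * (R k * y) + (a' k - b₀) * ρ k * y * 1ℚ
        ≡⟨ cong (λ s → a₀ * (R k * y) + s) (rearrange₂ b₀ (a' k) (ρ k) y) ⟩
      a₀ * (R k * y) + 1ℚ * (1ℚ * (ρ k * (a' k * y)) + (- b₀) * (ρ k * y)) ∎
      where
      y = a' k ^' n
      K = 1ℚ ÷' (a' k - a₀)
      rearrange₁ : ∀ a b k ρ K y →
        (k - b) * K * ρ * (k * y) ≡ a * ((k - b) * K * ρ * y) + (k - b) * ρ * y * ((k - a) * K)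
      rearrange₁ = solve-∀ ℚ-ring
      rearrange₂ : ∀ b k ρ y → (k - b) * ρ * y * 1ℚ ≡ 1ℚ * (1ℚ * (ρ * (k * y)) + (- b) * (ρ * y))
      rearrange₂ = solve-∀ ℚ-ring

    coefficients : ∀ n → H (suc n) ≡ R₀ * (a₀ ^' n) + sumFin l (λ k → R k * (a' k ^' n))
    coefficients zero = begin
      a₀ * H 0 + (h 1 - b₀ * h 0)
        ≡⟨ cong₂ (λ s t → a₀ * s + (t - b₀ * s)) (mulRatios-zero l b' a' one) (mulRatios-coefficients l b' a' a'-inj 0) ⟩
      a₀ * 1ℚ + (S - b₀ * 1ℚ)
        ≡⟨ rearrange a₀ b₀ S Σa₀ ⟩
      (a₀ - b₀) * (1ℚ * (1ℚ + Σa₀)) * 1ℚ + (1ℚ * S + (- (a₀ - b₀)) * Σa₀)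
        ≡⟨ cong₂ _+_
             (cong (λ s → (a₀ - b₀) * (1ℚ * s) * 1ℚ) (sym (partial-fractions l b' a' a'-inj a₀ a₀≢)))
             (sym (sumFin-linear l 1ℚ (- (a₀ - b₀)) initial)) ⟩
      R₀ * 1ℚ + sumFin l (λ k → R k * 1ℚ) ∎
      where
      S = sumFin l (λ k → ρ k * 1ℚ)
      rearrange : ∀ a b S T →
        a * 1ℚ + (S - b * 1ℚ) ≡ (a - b) * (1ℚ * (1ℚ + T)) * 1ℚ + (1ℚ * S + (- (a - b)) * T)
      rearrange = solve-∀ ℚ-ring
    coefficients (suc n) = begin
      a₀ * H (suc n) + (h (suc (suc n)) - b₀ * h (suc n))
        ≡⟨ cong₂ (λ s t → a₀ * s + t) (coefficients n)
             (cong₂ (λ s t → s - b₀ * t) (mulRatios-coefficients l b' a' a'-inj (suc n))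
                                         (mulRatios-coefficients l b' a' a'-inj n)) ⟩
      a₀ * (R₀ * (a₀ ^' n) + U) + (S (suc n) - b₀ * S n)
        ≡⟨ rearrange a₀ b₀ R₀ (a₀ ^' n) U (S (suc n)) (S n) ⟩
      R₀ * (a₀ * (a₀ ^' n)) + (a₀ * U + 1ℚ * (1ℚ * S (suc n) + (- b₀) * S n))
        ≡⟨ cong (λ s → R₀ * (a₀ * (a₀ ^' n)) + (a₀ * U + 1ℚ * s)) (sym (sumFin-linear l 1ℚ (- b₀) λ _ → refl)) ⟩
      R₀ * (a₀ * (a₀ ^' n)) + (a₀ * U + 1ℚ * sumFin l (λ k → 1ℚ * (ρ k * (a' k ^' suc n)) + (- b₀) * (ρ k * (a' k ^' n))))
        ≡⟨ cong (λ s → R₀ * (a₀ * (a₀ ^' n)) + s) (sym (sumFin-linear l a₀ 1ℚ (step n))) ⟩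
      R₀ * (a₀ ^' suc n) + sumFin l (λ k → R k * (a' k ^' suc n)) ∎
      where
      S : ℕ → ℚ
      S m = sumFin l (λ k → ρ k * (a' k ^' m))
      U = sumFin l (λ k → R k * (a' k ^' n))
      rearrange : ∀ a b r y U S₁ S →
        a * (r * y + U) + (S₁ - b * S) ≡ r * (a * y) + (a * U + 1ℚ * (1ℚ * S₁ + (- b) * S))
      rearrange = solve-∀ ℚ-ring

  -- The residues at the poles y = λₖ - k + 1

  -- The content j - i of the first cell beyond the end of row i; these are the poles aᵢ.
  contentEnd : ∀ {l} → (Fin l → ℕ) → Fin l → ℚ
  contentEnd lam i = ℤtoℚ (+ 1 ℤ.+ + lam i ℤ.- idx i)

  -- The content of the first cell of row i.
  rowShift : ∀ {l} → Fin l → ℚ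
  rowShift i = ℤtoℚ (+ 1 ℤ.- idx i)

  contentEnd-expand : ∀ {l} (lam : Fin l → ℕ) i → contentEnd lam i ≡ ℕtoℚ (lam i) - ℕtoℚ (toℕ i)
  contentEnd-expand lam i = begin
    ℤtoℚ (+ 1 ℤ.+ + lam i ℤ.- idx i)               ≡⟨ ℤtoℚ-minus (+ suc (lam i)) (idx i) ⟩
    ℕtoℚ (suc (lam i)) - ℕtoℚ (suc (toℕ i))        ≡⟨ cong₂ _-_ (ℕtoℚ-suc (lam i)) (ℕtoℚ-suc (toℕ i)) ⟩
    1ℚ + ℕtoℚ (lam i) - (1ℚ + ℕtoℚ (toℕ i))        ≡⟨ rearrange (ℕtoℚ (lam i)) (ℕtoℚ (toℕ i)) ⟩
    ℕtoℚ (lam i) - ℕtoℚ (toℕ i)                    ∎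
    where
    rearrange : ∀ x y → 1ℚ + x - (1ℚ + y) ≡ x - y
    rearrange = solve-∀ ℚ-ring

  contentEnd-minus-1 : ∀ {l} (lam : Fin l → ℕ) i → ℤtoℚ (+ lam i ℤ.- idx i) ≡ contentEnd lam i - 1ℚ
  contentEnd-minus-1 lam i = begin
    ℤtoℚ (+ lam i ℤ.- idx i)                       ≡⟨ ℤtoℚ-minus (+ lam i) (idx i) ⟩
    ℕtoℚ (lam i) - ℕtoℚ (suc (toℕ i))              ≡⟨ cong (λ s → ℕtoℚ (lam i) - s) (ℕtoℚ-suc (toℕ i)) ⟩
    ℕtoℚ (lam i) - (1ℚ + ℕtoℚ (toℕ i))             ≡⟨ rearrange (ℕtoℚ (lam i)) (ℕtoℚ (toℕ i)) ⟩
    ℕtoℚ (lam i) - ℕtoℚ (toℕ i) - 1ℚ               ≡⟨ cong (_- 1ℚ) (contentEnd-expand lam i) ⟨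
    contentEnd lam i - 1ℚ                          ∎
    where
    rearrange : ∀ x y → x - (1ℚ + y) ≡ x - y - 1ℚ
    rearrange = solve-∀ ℚ-ring

  rowShift-expand : ∀ {l} (i : Fin l) → rowShift i ≡ 0ℚ - ℕtoℚ (toℕ i)
  rowShift-expand i = trans (ℤtoℚ-minus (+ 1) (idx i))
    (trans (cong (λ s → 1ℚ - s) (ℕtoℚ-suc (toℕ i))) (rearrange (ℕtoℚ (toℕ i))))
    where
    rearrange : ∀ y → 1ℚ - (1ℚ + y) ≡ 0ℚ - y
    rearrange = solve-∀ ℚ-ring

  -- The poles are simple because λᵢ - i strictly decreases. The equation is rearranged without
  -- subtraction so that it can be pulled back to ℕ.
  contentEnd-injective : ∀ {l} {lam : Fin l → ℕ} → IsPartition l lam →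
    ∀ {i k} → contentEnd lam i ≡ contentEnd lam k → i ≡ k
  contentEnd-injective {l} {lam} partition {i} {k} eq =
    Fin.toℕ-injective (ℕ.≤-antisym (half i k crossed) (half k i (sym crossed)))
    where
    cross : ∀ x y x' y' → x - y ≡ x' - y' → x + y' ≡ x' + y
    cross x y x' y' e = trans (rearrange x y y') (trans (cong (_+ (y + y')) e) (rearrange' x' y y'))
      where
      rearrange : ∀ x y y' → x + y' ≡ x - y + (y + y')
      rearrange = solve-∀ ℚ-ring
      rearrange' : ∀ x y y' → x - y' + (y + y') ≡ x + y
      rearrange' = solve-∀ ℚ-ring
    crossed : lam i ℕ.+ toℕ k ≡ lam k ℕ.+ toℕ i
    crossed = ℤ.+-injective (ℤtoℚ-injective (begin
      ℕtoℚ (lam i ℕ.+ toℕ k)          ≡⟨ ℤtoℚ-+ (+ lam i) (+ toℕ k) ⟩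
      ℕtoℚ (lam i) + ℕtoℚ (toℕ k)     ≡⟨ cross (ℕtoℚ (lam i)) (ℕtoℚ (toℕ i)) (ℕtoℚ (lam k)) (ℕtoℚ (toℕ k))
                                          (trans (sym (contentEnd-expand lam i)) (trans eq (contentEnd-expand lam k))) ⟩
      ℕtoℚ (lam k) + ℕtoℚ (toℕ i)     ≡⟨ ℤtoℚ-+ (+ lam k) (+ toℕ i) ⟨
      ℕtoℚ (lam k ℕ.+ toℕ i)          ∎))
    -- If k ≤ i, then λᵢ ≤ λₖ, hence λₖ + i = λᵢ + k ≤ λₖ + k, and λₖ cancels.
    half : ∀ i k → lam i ℕ.+ toℕ k ≡ lam k ℕ.+ toℕ i → toℕ i ℕ.≤ toℕ k
    half i k e with ℕ.≤-total (toℕ i) (toℕ k)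
    ... | inj₁ i≤k = i≤k
    ... | inj₂ k≤i = ℕ.+-cancelˡ-≤ (lam k) (toℕ i) (toℕ k)
      (ℕ.≤-trans (ℕ.≤-reflexive (sym e)) (ℕ.+-monoˡ-≤ (toℕ k) (IsPartition.decreasing partition k i k≤i)))

  -- The constant -p is the diagonal factor aₖ - (p + aₖ). The falling factorial has the right
  -- argument since aₖ - 1 + l = λₖ + l - k.
  residue-d : ∀ l (lam : Fin l → ℕ) p k →
    residue l (λ i → ℕtoℚ p + contentEnd lam i) (contentEnd lam) k * fall (contentEnd lam k + (- 1ℚ + ℕtoℚ l)) p ≡
    (- ℕtoℚ p) * d l lam k p
  residue-d l lam p k = begin
    (a k - (ℕtoℚ p + a k)) * prodFin l factor * fall (a k + (- 1ℚ + ℕtoℚ l)) p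
      ≡⟨ cong₂ (λ s t → (a k - (ℕtoℚ p + a k)) * s * fall t p) (prodFin-cong l factor-eq) top-eq ⟩
    (a k - (ℕtoℚ p + a k)) * P * fall (ℤtoℚ (+ lam k ℤ.+ + l ℤ.- idx k)) p
      ≡⟨ rearrange (a k) (ℕtoℚ p) P (fall (ℤtoℚ (+ lam k ℤ.+ + l ℤ.- idx k)) p) ⟩
    (- ℕtoℚ p) * d l lam k p ∎
    where
    a = contentEnd lam
    factor : Fin l → ℚ
    factor i = if does (i Fin.≟ k) then 1ℚ else ((a k - (ℕtoℚ p + a i)) ÷' (a k - a i))
    P = prodFin l (λ i → if does (i Fin.≟ k) then 1ℚ else
      (ℤtoℚ (+ lam k ℤ.- + lam i ℤ.+ idx i ℤ.- idx k ℤ.- + p) ÷' ℤtoℚ (+ lam k ℤ.- + lam i ℤ.+ idx i ℤ.- idx k)))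
    denominator : ∀ i → a k - a i ≡ ℤtoℚ (+ lam k ℤ.- + lam i ℤ.+ idx i ℤ.- idx k)
    denominator i = begin
      a k - a i
        ≡⟨ cong₂ _-_ (contentEnd-expand lam k) (contentEnd-expand lam i) ⟩
      ℕtoℚ (lam k) - ℕtoℚ (toℕ k) - (ℕtoℚ (lam i) - ℕtoℚ (toℕ i))
        ≡⟨ rearrange₁ (ℕtoℚ (lam k)) (ℕtoℚ (toℕ k)) (ℕtoℚ (lam i)) (ℕtoℚ (toℕ i)) ⟩
      ℕtoℚ (lam k) - ℕtoℚ (lam i) + (1ℚ + ℕtoℚ (toℕ i)) - (1ℚ + ℕtoℚ (toℕ k))
        ≡⟨ cong₂ (λ s t → ℕtoℚ (lam k) - ℕtoℚ (lam i) + s - t) (ℕtoℚ-suc (toℕ i)) (ℕtoℚ-suc (toℕ k)) ⟨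
      ℕtoℚ (lam k) - ℕtoℚ (lam i) + ℤtoℚ (idx i) - ℤtoℚ (idx k)
        ≡⟨ cong (λ s → s + ℤtoℚ (idx i) - ℤtoℚ (idx k)) (ℤtoℚ-minus (+ lam k) (+ lam i)) ⟨
      ℤtoℚ (+ lam k ℤ.- + lam i) + ℤtoℚ (idx i) - ℤtoℚ (idx k)
        ≡⟨ cong (_- ℤtoℚ (idx k)) (ℤtoℚ-+ (+ lam k ℤ.- + lam i) (idx i)) ⟨
      ℤtoℚ (+ lam k ℤ.- + lam i ℤ.+ idx i) - ℤtoℚ (idx k)
        ≡⟨ ℤtoℚ-minus (+ lam k ℤ.- + lam i ℤ.+ idx i) (idx k) ⟨
      ℤtoℚ (+ lam k ℤ.- + lam i ℤ.+ idx i ℤ.- idx k) ∎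
      where
      rearrange₁ : ∀ x y x' y' → x - y - (x' - y') ≡ x - x' + (1ℚ + y') - (1ℚ + y)
      rearrange₁ = solve-∀ ℚ-ring
    numerator : ∀ i → a k - (ℕtoℚ p + a i) ≡ ℤtoℚ (+ lam k ℤ.- + lam i ℤ.+ idx i ℤ.- idx k ℤ.- + p)
    numerator i = trans (rearrange₁ (a k) (ℕtoℚ p) (a i)) (trans (cong (_- ℕtoℚ p) (denominator i))
      (sym (ℤtoℚ-minus (+ lam k ℤ.- + lam i ℤ.+ idx i ℤ.- idx k) (+ p))))
      where
      rearrange₁ : ∀ x p y → x - (p + y) ≡ x - y - p
      rearrange₁ = solve-∀ ℚ-ring
    factor-eq : ∀ i → factor i ≡ (if does (i Fin.≟ k) then 1ℚ else
      (ℤtoℚ (+ lam k ℤ.- + lam i ℤ.+ idx i ℤ.- idx k ℤ.- + p) ÷' ℤtoℚ (+ lam k ℤ.- + lam i ℤ.+ idx i ℤ.- idx k)))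
    factor-eq i = cong (if does (i Fin.≟ k) then 1ℚ else_) (cong₂ _÷'_ (numerator i) (denominator i))
    top-eq : a k + (- 1ℚ + ℕtoℚ l) ≡ ℤtoℚ (+ lam k ℤ.+ + l ℤ.- idx k)
    top-eq = begin
      a k + (- 1ℚ + ℕtoℚ l)
        ≡⟨ cong (_+ (- 1ℚ + ℕtoℚ l)) (contentEnd-expand lam k) ⟩
      ℕtoℚ (lam k) - ℕtoℚ (toℕ k) + (- 1ℚ + ℕtoℚ l)
        ≡⟨ rearrange₁ (ℕtoℚ (lam k)) (ℕtoℚ (toℕ k)) (ℕtoℚ l) ⟩
      ℕtoℚ (lam k) + ℕtoℚ l - (1ℚ + ℕtoℚ (toℕ k))
        ≡⟨ cong₂ _-_ (ℤtoℚ-+ (+ lam k) (+ l)) (ℕtoℚ-suc (toℕ k)) ⟨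
      ℤtoℚ (+ lam k ℤ.+ + l) - ℤtoℚ (idx k)
        ≡⟨ ℤtoℚ-minus (+ lam k ℤ.+ + l) (idx k) ⟨
      ℤtoℚ (+ lam k ℤ.+ + l ℤ.- idx k) ∎
      where
      rearrange₁ : ∀ x y l → x - y + (- 1ℚ + l) ≡ x + l - (1ℚ + y)
      rearrange₁ = solve-∀ ℚ-ring
    rearrange : ∀ a p P F → (a - (p + a)) * P * F ≡ (- p) * (F * P)
    rearrange = solve-∀ ℚ-ring

  -- Moments of d(k,p)

  fallShift-lhsSeries : ∀ l (lam : Fin l → ℕ) → IsPartition l lam → ∀ m n →
    fallShift 0ℚ (suc (suc m)) (lhsSeries l lam (ℕtoℚ (suc m))) n ≡
    (- ℕtoℚ (suc m)) * sumFin l (λ k → d l lam k (suc m) * (contentEnd lam k ^' n))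
  fallShift-lhsSeries l lam partition m n = begin
    -- `1ℚ + - 1ℚ` computes to `0ℚ`; in this form the factor y of (y)_{p+1} = y (y-1)_p can be split
    -- off at the top.
    fallShift (1ℚ + - 1ℚ) (suc p) G n
      ≡⟨ fallShift-top (- 1ℚ) p G n ⟩
    fallShift (- 1ℚ) p (λ k → G (suc k) + 0ℚ * G k) n
      ≡⟨ fallShift-comm (- 1ℚ) p 0ℚ G n ⟩
    fallShift (- 1ℚ) p G (suc n) + 0ℚ * fallShift (- 1ℚ) p G n
      ≡⟨ trans (cong (λ s → fallShift (- 1ℚ) p G (suc n) + s) (ℚ.*-zeroˡ (fallShift (- 1ℚ) p G n)))
           (ℚ.+-identityʳ (fallShift (- 1ℚ) p G (suc n))) ⟩
    fallShift (- 1ℚ) p G (suc n)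
      ≡⟨ fallShift-cong (- 1ℚ) p (prodSeries-ratios l (λ i → x + a i) (λ i → x + rowShift i) rowShift a) (suc n) ⟩
    fallShift (- 1ℚ) p (mulRatios l rowShift (λ i → x + rowShift i) h) (suc n)
      ≡⟨ fallShift-mulRatios m l 0ℚ rowShift rowShift-expand h (suc n) ⟩
    fallShift γ p h (suc n)
      -- The index `suc n`, left by the factor y, skips the constant coefficient of `h`, so only the
      -- geometric part is seen.
      ≡⟨ fallShift-shift γ p h n ⟨
    fallShift γ p (h ∘ suc) n
      ≡⟨ fallShift-cong γ p (mulRatios-coefficients l (λ i → x + a i) a (contentEnd-injective partition)) n ⟩
    fallShift γ p (λ k → sumFin l (λ i → ρ i * (a i ^' k))) n
      ≡⟨ fallShift-geometric γ p l ρ a n ⟩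
    sumFin l (λ i → ρ i * fall (a i + γ) p * (a i ^' n))
      ≡⟨ sumFin-cong l (λ i → trans (cong (_* (a i ^' n)) (residue-d l lam p i))
           (ℚ.*-assoc (- x) (d l lam i p) (a i ^' n))) ⟩
    sumFin l (λ i → (- x) * (d l lam i p * (a i ^' n)))
      ≡⟨ sumFin-*ˡ l (- x) (λ i → d l lam i p * (a i ^' n)) ⟩
    (- x) * sumFin l (λ i → d l lam i p * (a i ^' n)) ∎
    where
    p = suc m
    x = ℕtoℚ p
    a = contentEnd lam
    γ = - 1ℚ + ℕtoℚ l
    G = lhsSeries l lam x
    h = mulRatios l (λ i → x + a i) a one
    ρ = residue l (λ i → x + a i) a

  d-moments : ∀ l (lam : Fin l → ℕ) → IsPartition l lam → ∀ m n →
    sumFin l (λ k → d l lam k (suc m) * (contentEnd lam k ^' n)) ≡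
    sumℕ (suc (suc (suc m))) (λ t → ℤtoℚ (stirlingℕ (suc (suc m)) t) * c l lam (n ℕ.+ t) (ℕtoℚ (suc m)))
  d-moments l lam partition m n = begin
    M
      ≡⟨ ℚ.*-identityʳ M ⟨
    M * 1ℚ
      ≡⟨ cong (M *_) (÷'-cancel 1ℚ x≢0) ⟨
    M * (x * (1ℚ ÷' x))
      ≡⟨ rearrange₁ M x (1ℚ ÷' x) ⟩
    (- (1ℚ ÷' x)) * ((- x) * M)
      ≡⟨ cong ((- (1ℚ ÷' x)) *_) (fallShift-lhsSeries l lam partition m n) ⟨
    (- (1ℚ ÷' x)) * fallShift 0ℚ q G n
      ≡⟨ cong ((- (1ℚ ÷' x)) *_) (fallShift-stirling q G n) ⟩
    (- (1ℚ ÷' x)) * sumℕ (suc q) (λ t → ℤtoℚ (stirlingℕ q t) * G (n ℕ.+ t))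
      ≡⟨ sumℕ-*ˡ (suc q) (- (1ℚ ÷' x)) (λ t → ℤtoℚ (stirlingℕ q t) * G (n ℕ.+ t)) ⟨
    sumℕ (suc q) (λ t → (- (1ℚ ÷' x)) * (ℤtoℚ (stirlingℕ q t) * G (n ℕ.+ t)))
      -- The factor -1/x turns each coefficient of `G` into the corresponding `c`, as in the
      -- definition of the latter.
      ≡⟨ sumℕ-cong (suc q) (λ t → trans
           (rearrange₂ (1ℚ ÷' x) (ℤtoℚ (stirlingℕ q t)) (G (n ℕ.+ t)))
           (cong (ℤtoℚ (stirlingℕ q t) *_) (sym (÷'-inverse (- G (n ℕ.+ t)) x)))) ⟩
    sumℕ (suc q) (λ t → ℤtoℚ (stirlingℕ q t) * c l lam (n ℕ.+ t) x) ∎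
    where
    q = suc (suc m)
    x = ℕtoℚ (suc m)
    G = lhsSeries l lam x
    M = sumFin l (λ k → d l lam k (suc m) * (contentEnd lam k ^' n))
    x≢0 : x ≢ 0ℚ
    x≢0 eq with ℤtoℚ-injective {+ suc m} {+ 0} eq
    ... | ()
    rearrange₁ : ∀ M x y → M * (x * y) ≡ (- y) * ((- x) * M)
    rearrange₁ = solve-∀ ℚ-ring
    rearrange₂ : ∀ y s g → (- y) * (s * g) ≡ s * (- g * y)
    rearrange₂ = solve-∀ ℚ-ring

  d-shifted-moments : ∀ l (lam : Fin l → ℕ) → IsPartition l lam → ∀ m r →
    sumFin l (λ k → d l lam k (suc m) * (ℤtoℚ (+ lam k ℤ.- idx k) ^' r)) ≡
    ((- 1ℚ) ^' r) * sumℕ (suc (r ℕ.+ suc (suc (suc m)))) (λ i → sumℕ (suc r) (λ j →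
      ((- 1ℚ) ^' j) * ℕtoℚ (r C j) * ℤtoℚ (stirling (suc (suc m)) (+ i ℤ.- + j)) * c l lam i (ℕtoℚ (suc m))))
  d-shifted-moments l lam partition m r = begin
    sumFin l (λ k → D k * (ℤtoℚ (+ lam k ℤ.- idx k) ^' r))
      ≡⟨ sumFin-cong l expand ⟩
    sumFin l (λ k → ((- 1ℚ) ^' r) * sumℕ (suc r) (λ j → β j * (D k * (a k ^' j))))
      ≡⟨ sumFin-*ˡ l ((- 1ℚ) ^' r) (λ k → sumℕ (suc r) (λ j → β j * (D k * (a k ^' j)))) ⟩
    ((- 1ℚ) ^' r) * sumFin l (λ k → sumℕ (suc r) (λ j → β j * (D k * (a k ^' j))))
      ≡⟨ cong (((- 1ℚ) ^' r) *_) collect ⟩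
    ((- 1ℚ) ^' r) * sumℕ N (λ i → sumℕ (suc r) (λ j → β j * s i j * κ i)) ∎
    where
    q = suc (suc m)
    N = suc (r ℕ.+ suc q)
    a = contentEnd lam
    D : Fin l → ℚ
    D k = d l lam k (suc m)
    κ β : ℕ → ℚ
    κ i = c l lam i (ℕtoℚ (suc m))
    β j = ((- 1ℚ) ^' j) * ℕtoℚ (r C j)
    s : ℕ → ℕ → ℚ
    s i j = ℤtoℚ (stirling q (+ i ℤ.- + j))
    expand : ∀ k → D k * (ℤtoℚ (+ lam k ℤ.- idx k) ^' r) ≡
      ((- 1ℚ) ^' r) * sumℕ (suc r) (λ j → β j * (D k * (a k ^' j)))
    expand k = begin
      D k * (ℤtoℚ (+ lam k ℤ.- idx k) ^' r)
        ≡⟨ cong (λ y → D k * (y ^' r)) (contentEnd-minus-1 lam k) ⟩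
      D k * ((a k - 1ℚ) ^' r)
        ≡⟨ cong (D k *_) (alternating-binomial (a k) r) ⟩
      D k * (((- 1ℚ) ^' r) * sumℕ (suc r) (λ j → β j * (a k ^' j)))
        ≡⟨ swap (D k) ((- 1ℚ) ^' r) (sumℕ (suc r) (λ j → β j * (a k ^' j))) ⟩
      ((- 1ℚ) ^' r) * (D k * sumℕ (suc r) (λ j → β j * (a k ^' j)))
        ≡⟨ cong (((- 1ℚ) ^' r) *_) (sumℕ-*ˡ (suc r) (D k) (λ j → β j * (a k ^' j))) ⟨
      ((- 1ℚ) ^' r) * sumℕ (suc r) (λ j → D k * (β j * (a k ^' j)))
        ≡⟨ cong (((- 1ℚ) ^' r) *_) (sumℕ-cong (suc r) λ j → swap (D k) (β j) (a k ^' j)) ⟩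
      ((- 1ℚ) ^' r) * sumℕ (suc r) (λ j → β j * (D k * (a k ^' j))) ∎
      where
      swap : ∀ x y z → x * (y * z) ≡ y * (x * z)
      swap = solve-∀ ℚ-ring
    -- The common range runs one index past r + p + 1, so the slack is `suc r ∸ j` rather than
    -- `r ∸ j`.
    length-eq : ∀ j → j ℕ.< suc r → j ℕ.+ (suc q ℕ.+ (suc r ℕ.∸ j)) ≡ N
    length-eq j j≤r = begin
      j ℕ.+ (suc q ℕ.+ (suc r ℕ.∸ j))    ≡⟨ ℕ.+-assoc j (suc q) (suc r ℕ.∸ j) ⟨
      j ℕ.+ suc q ℕ.+ (suc r ℕ.∸ j)      ≡⟨ cong (ℕ._+ (suc r ℕ.∸ j)) (ℕ.+-comm j (suc q)) ⟩
      suc q ℕ.+ j ℕ.+ (suc r ℕ.∸ j)      ≡⟨ ℕ.+-assoc (suc q) j (suc r ℕ.∸ j) ⟩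
      suc q ℕ.+ (j ℕ.+ (suc r ℕ.∸ j))    ≡⟨ cong (suc q ℕ.+_) (ℕ.m+[n∸m]≡n (ℕ.<⇒≤ j≤r)) ⟩
      suc q ℕ.+ suc r                    ≡⟨ ℕ.+-comm (suc q) (suc r) ⟩
      N                                  ∎
    moment : ∀ j → j ℕ.< suc r →
      sumFin l (λ k → β j * (D k * (a k ^' j))) ≡ sumℕ N (λ i → β j * s i j * κ i)
    moment j j≤r = begin
      sumFin l (λ k → β j * (D k * (a k ^' j)))
        ≡⟨ sumFin-*ˡ l (β j) (λ k → D k * (a k ^' j)) ⟩
      β j * sumFin l (λ k → D k * (a k ^' j))
        ≡⟨ cong (β j *_) (d-moments l lam partition m j) ⟩
      β j * sumℕ (suc q) (λ t → ℤtoℚ (stirlingℕ q t) * κ (j ℕ.+ t))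
        ≡⟨ cong (β j *_) (sumℕ-stirling-shift q j (suc r ℕ.∸ j) κ) ⟨
      β j * sumℕ (j ℕ.+ (suc q ℕ.+ (suc r ℕ.∸ j))) (λ i → s i j * κ i)
        ≡⟨ cong (λ n → β j * sumℕ n (λ i → s i j * κ i)) (length-eq j j≤r) ⟩
      β j * sumℕ N (λ i → s i j * κ i)
        ≡⟨ sumℕ-*ˡ N (β j) (λ i → s i j * κ i) ⟨
      sumℕ N (λ i → β j * (s i j * κ i))
        ≡⟨ sumℕ-cong N (λ i → ℚ.*-assoc (β j) (s i j) (κ i)) ⟨
      sumℕ N (λ i → β j * s i j * κ i) ∎
    collect : sumFin l (λ k → sumℕ (suc r) (λ j → β j * (D k * (a k ^' j)))) ≡
      sumℕ N (λ i → sumℕ (suc r) (λ j → β j * s i j * κ i))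
    collect = begin
      sumFin l (λ k → sumℕ (suc r) (λ j → β j * (D k * (a k ^' j))))
        ≡⟨ sumFin-sumℕ-swap l (suc r) (λ k j → β j * (D k * (a k ^' j))) ⟩
      sumℕ (suc r) (λ j → sumFin l (λ k → β j * (D k * (a k ^' j))))
        ≡⟨ sumℕ-cong< (suc r) moment ⟩
      sumℕ (suc r) (λ j → sumℕ N (λ i → β j * s i j * κ i))
        ≡⟨ sumℕ-swap (suc r) N (λ j i → β j * s i j * κ i) ⟩
      sumℕ N (λ i → sumℕ (suc r) (λ j → β j * s i j * κ i)) ∎

open import Data.Nat using (_≤_; _+_)
open import Data.Integer using (_-_)

theorem3 : (l : ℕ) (lam : Fin l → ℕ) → IsPartition l lam →
    (p : ℕ) → 1 ≤ p → (r : ℕ) →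
    sumFin l (λ k → d l lam k p * (ℤtoℚ (+ lam k - idx k) ^' r))
    ≡ ((- 1ℚ) ^' r) *
    sumℕ (suc (r + suc (suc p))) (λ i → sumℕ (suc r) (λ j →
    ((- 1ℚ) ^' j) * ℕtoℚ (r C j)
    * ℤtoℚ (stirling (suc p) (+ i - + j)) * c l lam i (ℕtoℚ p)))
theorem3 l lam partition (suc m) (s≤s z≤n) r = d-shifted-moments l lam partition m r
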